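{- Let $n\ge 1$. There exists a partition $\mathcal{U}_n=\bigcup_{C\in\mathcal{C}_n}C$ of the set $\mathcal U_n$ of embedded trees with $n$ edges into disjoint classes (called conjugacy classes), each of size at most $n+2$, such that for each class $C\in\mathcal{C}_n$: \begin{itemize} \item $2\cdot|C|=(n+2)\cdot|C\cap\mathcal{W}_n|$, where $\mathcal W_n\subset\mathcal U_n$ is the set of well labelled trees with $n$ edges; \item for any $W\in\mathcal{W}_n\cap C$, any $U\in C$ and any $k\geq1$, \[\widehat\Lambda_{k-2}(U)\;\leq\;\widehat\lambda_k(W)\;\leq\;\widehat\Lambda_{k+2}(U).\] \end{itemize}
   Context: A plane tree is a rooted planar map without cycles (equivalently, a rooted tree in which the children of each vertex are linearly ordered). An embedded tree (also called unconstrained well labelled tree) is a plane tree whose vertices carry integer labels such that the labels of any two adjacent vertices differ by at most $1$ (i.e. by $-1$, $0$ or $1$) and the label of the root vertex is $1$. $\mathcal U_n$ is the set of embedded trees with $n$ edges. A well labelled tree is an embedded tree all of whose labels are positive; $\mathcal W_n$ is the set of well labelled trees with $n$ edges. For a tree $T\in\mathcal U_n$ let $\lambda_k^{[T]}$ be the number of vertices of $T$ with label $k$. For $W\in\mathcal W_n$, the cumulated label distribution is $\widehat\lambda_k(W)=\sum_{\ell=1}^{k}\lambda_\ell^{[W]}$. For $U\in\mathcal U_n$ with minimal label $m$, the cumulated label distribution is taken relative to the minimum: $\widehat\Lambda_k(U)=\sum_{\ell=1}^k\lambda_{m+\ell-1}^{[U]}$. Empty sums (for $k\le 0$) are $0$.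 -}

module Defs where

open import Data.Integer as ℤ using (ℤ; 0ℤ; 1ℤ; +_; ∣_∣)
import Data.Integer.Properties as ℤₚ
open import Data.List using (List; []; _∷_; _++_; length; filter)
open import Data.List.Extrema ℤₚ.≤-totalOrder using (min)
open import Data.List.Membership.Propositional using (_∈_)
open import Data.List.Relation.Binary.Disjoint.Propositional using (Disjoint)
open import Data.List.Relation.Unary.All using (All; []; _∷_; all?)
open import Data.List.Relation.Unary.AllPairs using (AllPairs)
open import Data.List.Relation.Unary.Any using (Any)
open import Data.List.Relation.Unary.Unique.Propositional using (Unique)
open import Data.Nat as ℕ using (ℕ; zero; suc; _+_; _≤_)
open import Data.Product using (_×_; _,_)
open import Function using (_⇔_)
open import Relation.Binary.PropositionalEquality using (_≡_; _≢_)
open import Relation.Nullary using (Dec; yes; _×-dec_)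
open import Relation.Nullary.Decidable using (map′)

-- Plane trees with vertex labels in A.  (Data.Tree.Rose uses sized types and
-- is therefore not available under --safe.)
data Tree (A : Set) : Set where
  node : (a : A) (ts : List (Tree A)) → Tree A

module _ {A : Set} where

  root : Tree A → A
  root (node a _) = a

  mutual
    labels : Tree A → List A
    labels (node a ts) = a ∷ labelsᶠ ts

    labelsᶠ : List (Tree A) → List A
    labelsᶠ []       = []
    labelsᶠ (t ∷ ts) = labels t ++ labelsᶠ ts

  mutual
    edges : Tree A → ℕ
    edges (node _ ts) = edgesᶠ ts

    -- Counts, for each tree of the forest, also the edge joining its root to
    -- the common parent.
    edgesᶠ : List (Tree A) → ℕ
    edgesᶠ []       = 0
    edgesᶠ (t ∷ ts) = suc (edges t) + edgesᶠ ts

Close : ℤ → ℤ → Set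
Close i j = ∣ i ℤ.- j ∣ ≤ 1

data AdjacentClose : Tree ℤ → Set where
  node : ∀ {i ts} →
         All (λ t → Close i (root t) × AdjacentClose t) ts →
         AdjacentClose (node i ts)

𝒰 : ℕ → Tree ℤ → Set
𝒰 n T = edges T ≡ n × root T ≡ 1ℤ × AdjacentClose T

𝒲 : ℕ → Tree ℤ → Set
𝒲 n T = 𝒰 n T × All (0ℤ ℤ.<_) (labels T)

mutual
  adjacentClose? : ∀ T → Dec (AdjacentClose T)
  adjacentClose? (node i ts) =
    map′ node (λ { (node ps) → ps }) (adjacentCloseᶠ? i ts)

  adjacentCloseᶠ? : ∀ i ts →
    Dec (All (λ t → Close i (root t) × AdjacentClose t) ts)
  adjacentCloseᶠ? i []       = yes []
  adjacentCloseᶠ? i (t ∷ ts) =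
    map′ (λ { (p , ps) → p ∷ ps }) (λ { (p ∷ ps) → p , ps })
      (((∣ i ℤ.- root t ∣ ℕ.≤? 1) ×-dec adjacentClose? t)
        ×-dec adjacentCloseᶠ? i ts)

𝒰? : ∀ n T → Dec (𝒰 n T)
𝒰? n T =
  (edges T ℕ.≟ n) ×-dec ((root T ℤ.≟ 1ℤ) ×-dec adjacentClose? T)

𝒲? : ∀ n T → Dec (𝒲 n T)
𝒲? n T = 𝒰? n T ×-dec all? (0ℤ ℤ.<?_) (labels T)

labelCount : Tree ℤ → ℤ → ℕ
labelCount T k = length (filter (ℤ._≟ k) (labels T))

minLabel : Tree ℤ → ℤ
minLabel T = min (root T) (labels T)

-- sum₁ k f = f 1 + ⋯ + f k
sum₁ : ℕ → (ℕ → ℕ) → ℕ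
sum₁ zero    f = 0
sum₁ (suc k) f = sum₁ k f + f (suc k)

-- The sums for k ≤ 0 are empty, so an index k − 2 with k ∈ ℕ may be written
-- with truncated subtraction, k ∸ 2, without changing its meaning.
λ̂ : ℕ → Tree ℤ → ℕ
λ̂ k W = sum₁ k (λ ℓ → labelCount W (+ ℓ))

Λ̂ : ℕ → Tree ℤ → ℕ
Λ̂ k U = sum₁ k (λ ℓ → labelCount U (minLabel U ℤ.+ + ℓ ℤ.- 1ℤ))

-- A partition into finitely many finite classes.  Each class is a
-- duplicate-free list, so its cardinality is its length.
record IsPartition {A : Set} (P : A → Set) (𝒞 : List (List A)) : Set where
  field
    unique   : All Unique 𝒞
    nonEmpty : All (_≢ []) 𝒞
    disjoint : AllPairs Disjoint 𝒞
    union    : ∀ x → P x ⇔ Any (x ∈_) 𝒞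

{-# OPTIONS --safe #-}
module Submission where

-- An embedded tree with n edges is encoded by a binary tree with n inner nodes,
-- each carrying a bud, so that the labels of the vertices become the heights of
-- the leaves in a contour walk where a bud is a step +1 and a leaf a step −1.
-- Counting the root as a leaf there are n + 2 leaves, and the contour closes up
-- to a periodic walk that drops by 2 per period.  Moving the root to the next
-- leaf rotates this walk; the conjugacy classes are the orbits of this map.  The
-- tree is well labelled exactly when its root leaf reaches a new strict minimum,
-- which by the cycle lemma happens twice per period.  Up to a common shift,
-- rerooting lowers the leaves before the new root by 2 and fixes the others.

open import Defs
open import Data.Integer as ℤ using (ℤ; +_; +[1+_]; -[1+_]; 0ℤ; 1ℤ; -1ℤ; ∣_∣)
  renaming (suc to sucℤ; pred to predℤ; _+_ to _+ᶻ_; _-_ to _-ᶻ_; _≤_ to _≤ᶻ_; _<_ to _<ᶻ_)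
import Data.Integer.Properties as ℤₚ
open import Data.Integer.Tactic.RingSolver using (solve-∀)
open import Data.List as List
  using (List; []; _∷_; _++_; length; map; filter; deduplicate; cartesianProduct; cartesianProductWith)
open import Data.List.Extrema ℤₚ.≤-totalOrder using (min; min≤xs; argmin-sel)
open import Data.List.Membership.Propositional using (_∈_; find)
open import Data.List.Membership.Propositional.Properties
  using (∈-++⁺ˡ; ∈-++⁺ʳ; ∈-map⁺; ∈-map⁻; ∈-filter⁺; ∈-filter⁻; ∈-cartesianProduct⁺; ∈-cartesianProductWith⁺)
open import Data.List.Properties
  using (length-++; length-map; length-iterate; map-++; ++-assoc; ++-identityʳ; filter-++; filter-none;
         ∷-injective; ∷ʳ-injectiveˡ)
open import Data.List.Relation.Binary.Disjoint.Propositional using (Disjoint)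
open import Data.List.Relation.Binary.Permutation.Propositional using (_↭_; ↭-refl; ↭-sym; ↭-trans; ↭-reflexive)
open import Data.List.Relation.Binary.Permutation.Propositional.Properties
  using (++⁺; ++-comm; shift; ↭-length; filter-↭; All-resp-↭; ∈-resp-↭)
open import Data.List.Relation.Unary.All as All using (All; []; _∷_)
import Data.List.Relation.Unary.All.Properties as Allₚ
open import Data.List.Relation.Unary.AllPairs as AllPairs using (AllPairs; []; _∷_)
import Data.List.Relation.Unary.AllPairs.Properties as AllPairsₚ
open import Data.List.Relation.Unary.Any as Any using (Any; here; there)
import Data.List.Relation.Unary.Any.Properties as Anyₚ
open import Data.List.Relation.Unary.Unique.Propositional using (Unique)
import Data.List.Relation.Unary.Unique.DecSetoid.Properties as DecUniqueₚ
import Data.List.Relation.Unary.Unique.Propositional.Properties as Uniqueₚ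
open import Data.Nat as ℕ using (ℕ; zero; suc; _+_; _*_; _∸_; _≤_; _<_; z≤n; s≤s; s≤s⁻¹; z<s; NonZero)
open import Data.Nat.DivMod using (_/_; _%_; m≡m%n+[m/n]*n; m%n<n)
open import Data.Nat.GeneralisedArithmetic using (iterate)
import Data.Nat.Properties as ℕₚ
open import Data.Product using (Σ-syntax; ∃-syntax; _×_; _,_; proj₁; proj₂)
open import Data.Sum using (inj₁; inj₂)
open import Function using (_∘_; id; mk⇔)
open import Level using (0ℓ)
open import Relation.Binary using (DecidableEquality; DecSetoid)
open import Relation.Binary.PropositionalEquality
  using (_≡_; _≢_; refl; sym; trans; cong; cong₂; subst; subst₂; module ≡-Reasoning)
open import Relation.Nullary using (¬_; Dec; yes; no; contradiction)
open import Relation.Nullary.Decidable using (map′; _×-dec_)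
open import Relation.Unary using (Pred; Decidable)


-- Counting in lists

-- A blossom tree with a rotational symmetry has an orbit shorter than `n + 2`. The minima are
-- therefore counted over a full turn of `n + 2` rerootings, where there are always two, and this
-- count is divided by the number of times that the turn runs through the orbit. For the bounds, the
-- well labelled tree `W` is taken as the origin. Its heights are at least 1, so those of a proper
-- rerooting `U` within one turn are at least -1 and include 0, the height of the old root leaf. The
-- minimum of `U` is thus at most 2 below that of `W`, which is the shift in the upper bound; the
-- shift in the lower bound absorbs the drop by 2 of the leaves passed. What remains is the exchange
-- of one leaf: the new root is lost, the old root is gained.

least : {P : Pred ℕ 0ℓ} → Decidable P → ∀ n → P n →
        ∃[ m ] m ≤ n × P m × (∀ {k} → k < m → ¬ P k)
least P? zero    p = 0 , z≤n , p , λ ()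
least P? (suc n) p with P? 0
... | yes p₀ = 0 , z≤n , p₀ , λ ()
... | no ¬p₀ with least (P? ∘ suc) n p
...   | m , m≤n , pm , below = suc m , s≤s m≤n , pm , below′
  where
  below′ : ∀ {k} → k < suc m → ¬ _
  below′ {zero}  _         = ¬p₀
  below′ {suc k} (s≤s k<m) = below k<m

count : ∀ {A : Set} {P : Pred A 0ℓ} → Decidable P → List A → ℕ
count P? xs = length (filter P? xs)

module _ {A : Set} {P : Pred A 0ℓ} (P? : Decidable P) where

  count-accept : ∀ {x} → P x → ∀ xs → count P? (x ∷ xs) ≡ suc (count P? xs)
  count-accept {x} px xs with P? x
  ... | yes _  = refl
  ... | no ¬px = contradiction px ¬px

  count-reject : ∀ {x} → ¬ P x → ∀ xs → count P? (x ∷ xs) ≡ count P? xs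
  count-reject {x} ¬px xs with P? x
  ... | yes px = contradiction px ¬px
  ... | no _   = refl

  count-++ : ∀ xs ys → count P? (xs ++ ys) ≡ count P? xs + count P? ys
  count-++ xs ys = trans (cong length (filter-++ P? xs ys)) (length-++ (filter P? xs))

count-cong : ∀ {A : Set} {P Q : Pred A 0ℓ} (P? : Decidable P) (Q? : Decidable Q) {xs} →
             All (λ x → (P x → Q x) × (Q x → P x)) xs → count P? xs ≡ count Q? xs
count-cong P? Q? [] = refl
count-cong P? Q? {x ∷ xs} ((to , from) ∷ rest) with P? x | Q? x
... | yes _  | yes _  = cong suc (count-cong P? Q? rest)
... | no _   | no _   = count-cong P? Q? rest
... | yes px | no ¬qx = contradiction (to px) ¬qx
... | no ¬px | yes qx = contradiction (from qx) ¬px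

count-mono : ∀ {A : Set} {P Q : Pred A 0ℓ} (P? : Decidable P) (Q? : Decidable Q) →
             (∀ {x} → P x → Q x) → ∀ xs → count P? xs ≤ count Q? xs
count-mono P? Q? P⊆Q []       = z≤n
count-mono P? Q? P⊆Q (x ∷ xs) with P? x | Q? x
... | yes _  | yes _  = s≤s (count-mono P? Q? P⊆Q xs)
... | no _   | no _   = count-mono P? Q? P⊆Q xs
... | no _   | yes _  = ℕₚ.m≤n⇒m≤1+n (count-mono P? Q? P⊆Q xs)
... | yes px | no ¬qx = contradiction (P⊆Q px) ¬qx

count-strictMono : ∀ {A : Set} {P Q : Pred A 0ℓ} (P? : Decidable P) (Q? : Decidable Q) →
  (∀ {x} → P x → Q x) → ∀ {x xs} → x ∈ xs → ¬ P x → Q x → count P? xs < count Q? xs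
count-strictMono P? Q? P⊆Q {xs = x ∷ xs} (here refl) ¬px qx
  rewrite count-reject P? ¬px xs | count-accept Q? qx xs = s≤s (count-mono P? Q? P⊆Q xs)
count-strictMono P? Q? P⊆Q {xs = y ∷ xs} (there x∈) ¬px qx with P? y | Q? y
... | yes _  | yes _  = s≤s (count-strictMono P? Q? P⊆Q x∈ ¬px qx)
... | no _   | no _   = count-strictMono P? Q? P⊆Q x∈ ¬px qx
... | no _   | yes _  = ℕₚ.m≤n⇒m≤1+n (count-strictMono P? Q? P⊆Q x∈ ¬px qx)
... | yes py | no ¬qy = contradiction (P⊆Q py) ¬qy

count-map : ∀ {A B : Set} {P : Pred B 0ℓ} (P? : Decidable P) (g : A → B) xs →
            count P? (map g xs) ≡ count (P? ∘ g) xs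
count-map P? g []       = refl
count-map P? g (x ∷ xs) with P? (g x)
... | yes _ = cong suc (count-map P? g xs)
... | no _  = count-map P? g xs

count-∷-≤ : ∀ {A : Set} {P : Pred A 0ℓ} (P? : Decidable P) x xs → count P? (x ∷ xs) ≤ suc (count P? xs)
count-∷-≤ P? x xs with P? x
... | yes _ = ℕₚ.≤-refl
... | no _  = ℕₚ.n≤1+n _

count-↭ : ∀ {A : Set} {P : Pred A 0ℓ} (P? : Decidable P) {xs ys} → xs ↭ ys → count P? xs ≡ count P? ys
count-↭ P? xs↭ys = ↭-length (filter-↭ P? xs↭ys)

-- Orbits of a periodic map

module _ {A : Set} (f : A → A) where

  iterate-+ : ∀ x m n → iterate f x (m + n) ≡ iterate f (iterate f x m) n
  iterate-+ x zero    n = refl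
  iterate-+ x (suc m) n = iterate-+ (f x) m n

  iterate-suc : ∀ x n → iterate f (f x) n ≡ f (iterate f x n)
  iterate-suc x zero    = refl
  iterate-suc x (suc n) = iterate-suc (f x) n

  iterate-* : ∀ {x m} → iterate f x m ≡ x → ∀ k → iterate f x (k * m) ≡ x
  iterate-*         eq zero    = refl
  iterate-* {x} {m} eq (suc k) = begin
    iterate f x (m + k * m)           ≡⟨ iterate-+ x m (k * m) ⟩
    iterate f (iterate f x m) (k * m) ≡⟨ cong (λ y → iterate f y (k * m)) eq ⟩
    iterate f x (k * m)               ≡⟨ iterate-* eq k ⟩
    x                                 ∎
    where open ≡-Reasoning

  iterate-% : ∀ {x m} .{{_ : NonZero m}} → iterate f x m ≡ x →
              ∀ n → iterate f x (n % m) ≡ iterate f x n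
  iterate-% {x} {m} eq n = sym (begin
    iterate f x n
      ≡⟨ cong (iterate f x) (trans (m≡m%n+[m/n]*n n m) (ℕₚ.+-comm (n % m) _)) ⟩
    iterate f x (n / m * m + n % m)
      ≡⟨ iterate-+ x (n / m * m) (n % m) ⟩
    iterate f (iterate f x (n / m * m)) (n % m)
      ≡⟨ cong (λ y → iterate f y (n % m)) (iterate-* eq (n / m)) ⟩
    iterate f x (n % m) ∎)
    where open ≡-Reasoning

  listIterate-+ : ∀ x m n →
    List.iterate f x (m + n) ≡ List.iterate f x m ++ List.iterate f (iterate f x m) n
  listIterate-+ x zero    n = refl
  listIterate-+ x (suc m) n = cong (x ∷_) (listIterate-+ (f x) m n)

  ∈-listIterate⁺ : ∀ x {m k} → k < m → iterate f x k ∈ List.iterate f x m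
  ∈-listIterate⁺ x {suc m} {zero}  _         = here refl
  ∈-listIterate⁺ x {suc m} {suc k} (s≤s k<m) = there (∈-listIterate⁺ (f x) k<m)

  ∈-listIterate⁻ : ∀ x m {y} → y ∈ List.iterate f x m → ∃[ k ] k < m × iterate f x k ≡ y
  ∈-listIterate⁻ x (suc m) (here refl) = 0 , z<s , refl
  ∈-listIterate⁻ x (suc m) (there y∈)  with ∈-listIterate⁻ (f x) m y∈
  ... | k , k<m , eq = suc k , s≤s k<m , eq

  count-listIterate-* : {P : Pred A 0ℓ} (P? : Decidable P) → ∀ {x m} → iterate f x m ≡ x →
    ∀ k → count P? (List.iterate f x (k * m)) ≡ k * count P? (List.iterate f x m)
  count-listIterate-* P?         eq zero    = refl
  count-listIterate-* P? {x} {m} eq (suc k) = begin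
    count P? (List.iterate f x (m + k * m))
      ≡⟨ cong (count P?) (listIterate-+ x m (k * m)) ⟩
    count P? (List.iterate f x m ++ List.iterate f (iterate f x m) (k * m))
      ≡⟨ count-++ P? (List.iterate f x m) _ ⟩
    count P? (List.iterate f x m) + count P? (List.iterate f (iterate f x m) (k * m))
      ≡⟨ cong (λ y → count P? (List.iterate f x m) + count P? (List.iterate f y (k * m))) eq ⟩
    count P? (List.iterate f x m) + count P? (List.iterate f x (k * m))
      ≡⟨ cong (λ c → count P? (List.iterate f x m) + c) (count-listIterate-* P? eq k) ⟩
    suc k * count P? (List.iterate f x m) ∎
    where open ≡-Reasoning

-- A full turn takes `suc (ν x)` steps, and `ν` is constant along orbits; the least period may be a
-- proper divisor of the full turn.
module Orbits {A : Set} (_≟ᴬ_ : DecidableEquality A) (f : A → A) (ν : A → ℕ)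
              (ν-f : ∀ x → ν (f x) ≡ ν x)
              (f-periodic : ∀ x → iterate f x (suc (ν x)) ≡ x) where

  infix 4 _~_
  _~_ : A → A → Set
  x ~ y = ∃[ k ] iterate f x k ≡ y

  ν-iterate : ∀ x k → ν (iterate f x k) ≡ ν x
  ν-iterate x zero    = refl
  ν-iterate x (suc k) = trans (ν-iterate (f x) k) (ν-f x)

  ν-resp-~ : ∀ {x y} → x ~ y → ν y ≡ ν x
  ν-resp-~ {x} (k , refl) = ν-iterate x k

  ~-refl : ∀ {x} → x ~ x
  ~-refl = 0 , refl

  ~-trans : ∀ {x y z} → x ~ y → y ~ z → x ~ z
  ~-trans {x} (k , refl) (l , refl) = k + l , iterate-+ f x k l

  ~-sym : ∀ {x y} → x ~ y → y ~ x
  -- Together with the `k` steps already made, `k * ν x` more steps complete `k` full turns.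
  ~-sym {x} (k , refl) = k * ν x , (begin
    iterate f (iterate f x k) (k * ν x) ≡⟨ iterate-+ f x k (k * ν x) ⟨
    iterate f x (k + k * ν x)           ≡⟨ cong (iterate f x) (ℕₚ.*-suc k (ν x)) ⟨
    iterate f x (k * suc (ν x))         ≡⟨ iterate-* f (f-periodic x) k ⟩
    x                                   ∎)
    where open ≡-Reasoning

  -- Reduction modulo the full turn leaves finitely many candidates for `k`, which makes `_~_`
  -- decidable.
  ~-bounded : ∀ {x y} → x ~ y → ∃[ k ] k < suc (ν x) × iterate f x k ≡ y
  ~-bounded {x} (k , refl) = k % suc (ν x) , m%n<n k (suc (ν x)) , iterate-% f (f-periodic x) k

  _~?_ : ∀ x y → Dec (x ~ y)
  x ~? y = map′ (λ (k , _ , eq) → k , eq) ~-bounded (ℕₚ.anyUpTo? (λ k → iterate f x k ≟ᴬ y) (suc (ν x)))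

  ~-decSetoid : DecSetoid 0ℓ 0ℓ
  ~-decSetoid = record
    { Carrier = A ; _≈_ = _~_
    ; isDecEquivalence = record
      { isEquivalence = record { refl = ~-refl ; sym = ~-sym ; trans = ~-trans }
      ; _≟_ = _~?_ } }

  f-injective : ∀ {x y} → f x ≡ f y → x ≡ y
  f-injective {x} {y} eq = begin
    x                               ≡⟨ f-periodic x ⟨
    iterate f (f x) (ν x)           ≡⟨ cong₂ (iterate f) eq (trans (sym (ν-f x)) (trans (cong ν eq) (ν-f y))) ⟩
    iterate f (f y) (ν y)           ≡⟨ f-periodic y ⟩
    y                               ∎
    where open ≡-Reasoning

  iterate-cancel : ∀ {x y} i → iterate f x i ≡ iterate f y i → x ≡ y
  iterate-cancel zero    eq = eq
  iterate-cancel (suc i) eq = f-injective (iterate-cancel i eq)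

  -- The search runs over predecessors of periods, so that `period` is a successor: it can serve as
  -- a modulus, and orbits are visibly nonempty.
  leastPeriod : ∀ x → ∃[ p ] p ≤ ν x × iterate f x (suc p) ≡ x ×
                             (∀ {k} → k < p → ¬ iterate f x (suc k) ≡ x)
  leastPeriod x = least (λ p → iterate f x (suc p) ≟ᴬ x) (ν x) (f-periodic x)

  period : A → ℕ
  period x = suc (proj₁ (leastPeriod x))

  iterate-period : ∀ x → iterate f x (period x) ≡ x
  iterate-period x = proj₁ (proj₂ (proj₂ (leastPeriod x)))

  period-minimal : ∀ x {k} → suc k < period x → ¬ iterate f x (suc k) ≡ x
  period-minimal x (s≤s k<p) = proj₂ (proj₂ (proj₂ (leastPeriod x))) k<p

  -- The remainder of the full turn modulo the period is again a number of steps that returns to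
  -- `x`; being smaller than the least period, it is 0.
  period-divides : ∀ x → suc (ν x) ≡ suc (ν x) / period x * period x
  period-divides x with suc (ν x) % period x in eq
                      | m%n<n (suc (ν x)) (period x)
                      | trans (iterate-% f {m = period x} (iterate-period x) (suc (ν x))) (f-periodic x)
  ... | zero  | _   | _    = trans (m≡m%n+[m/n]*n (suc (ν x)) (period x)) (cong (_+ suc (ν x) / period x * period x) eq)
  ... | suc k | k<p | fᵏ≡x = contradiction fᵏ≡x (period-minimal x k<p)

  orbit : A → List A
  orbit x = List.iterate f x (period x)

  ∈-orbit⁺ : ∀ {x y} → x ~ y → y ∈ orbit x
  ∈-orbit⁺ {x} (k , refl) =
    subst (_∈ orbit x) (iterate-% f {m = period x} (iterate-period x) k) (∈-listIterate⁺ f x (m%n<n k (period x)))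

  ∈-orbit⁻ : ∀ {x y} → y ∈ orbit x → x ~ y
  ∈-orbit⁻ {x} y∈ with ∈-listIterate⁻ f x (period x) y∈
  ... | k , _ , eq = k , eq

  length-orbit : ∀ x → length (orbit x) ≡ period x
  length-orbit x = length-iterate f x (period x)

  length-orbit-≤ : ∀ x → length (orbit x) ≤ suc (ν x)
  length-orbit-≤ x = ℕₚ.≤-trans (ℕₚ.≤-reflexive (length-orbit x)) (s≤s (proj₁ (proj₂ (leastPeriod x))))

  orbit-unique : ∀ x → Unique (orbit x)
  orbit-unique x = unique x (period x) never-returns
    where
    -- Since `f` is injective, `i` applications can be cancelled, and a return to the `i`-th point
    -- becomes an early return to `x`.
    never-returns : ∀ {k} → suc k < period x → ∀ i → iterate f (iterate f x i) (suc k) ≢ iterate f x i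
    never-returns {k} k<p i eq = period-minimal x k<p (iterate-cancel i (begin
      iterate f (iterate f x (suc k)) i ≡⟨ iterate-+ f x (suc k) i ⟨
      iterate f x (suc k + i)           ≡⟨ cong (iterate f x) (ℕₚ.+-comm (suc k) i) ⟩
      iterate f x (i + suc k)           ≡⟨ iterate-+ f x i (suc k) ⟩
      iterate f (iterate f x i) (suc k) ≡⟨ eq ⟩
      iterate f x i                     ∎))
      where open ≡-Reasoning

    unique : ∀ y m → (∀ {k} → suc k < m → ∀ i → iterate f (iterate f y i) (suc k) ≢ iterate f y i) →
             Unique (List.iterate f y m)
    unique y zero    h = []
    unique y (suc m) h = All.tabulate distinct ∷ unique (f y) m (λ k<m i → h (ℕₚ.m<n⇒m<1+n k<m) (suc i))
      where
      distinct : ∀ {z} → z ∈ List.iterate f (f y) m → y ≢ z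
      distinct z∈ refl with ∈-listIterate⁻ f (f y) m z∈
      ... | k , k<m , eq = h (s≤s k<m) 0 eq

  -- A full turn runs through the orbit `suc (ν x) / period x` times, so the proportion of points
  -- satisfying `P` is the same in both; cross-multiplying avoids the division.
  count-orbit : {P : Pred A 0ℓ} (P? : Decidable P) → ∀ x →
    length (orbit x) * count P? (List.iterate f x (suc (ν x))) ≡ suc (ν x) * count P? (orbit x)
  count-orbit P? x = begin
    length (orbit x) * count P? (List.iterate f x (suc (ν x)))
      ≡⟨ cong₂ _*_ (length-orbit x) (cong (count P? ∘ List.iterate f x) (period-divides x)) ⟩
    period x * count P? (List.iterate f x (q * period x))
      ≡⟨ cong (period x *_) (count-listIterate-* f P? {m = period x} (iterate-period x) q) ⟩
    period x * (q * c) ≡⟨ ℕₚ.*-assoc (period x) q c ⟨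
    period x * q * c   ≡⟨ cong (_* c) (ℕₚ.*-comm (period x) q) ⟩
    q * period x * c   ≡⟨ cong (_* c) (period-divides x) ⟨
    suc (ν x) * c      ∎
    where
    open ≡-Reasoning
    q = suc (ν x) / period x
    c = count P? (orbit x)

  orbits : List A → List (List A)
  orbits xs = map orbit (deduplicate _~?_ xs)

  orbits-disjoint : ∀ xs → AllPairs Disjoint (orbits xs)
  orbits-disjoint xs = AllPairsₚ.map⁺ (AllPairs.map disjoint (DecUniqueₚ.deduplicate-! ~-decSetoid xs))
    where
    disjoint : ∀ {x y} → ¬ x ~ y → Disjoint (orbit x) (orbit y)
    disjoint x≁y (z∈x , z∈y) = x≁y (~-trans (∈-orbit⁻ z∈x) (~-sym (∈-orbit⁻ z∈y)))

  ∈-orbits⁻ : ∀ xs {C} → C ∈ orbits xs → ∃[ x ] x ∈ xs × C ≡ orbit x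
  ∈-orbits⁻ xs C∈ with find (Anyₚ.map⁻ C∈)
  ... | x , x∈ , C≡ = x , Anyₚ.deduplicate⁻ _~?_ x∈ , C≡

  orbits-cover : ∀ {xs x} → x ∈ xs → Any (x ∈_) (orbits xs)
  orbits-cover {xs} {x} x∈ = Anyₚ.map⁺ (Any.map ∈-orbit⁺ (Anyₚ.deduplicate⁺ _~?_
    (λ y~z z~x → ~-trans y~z z~x) (Any.map (λ { refl → ~-refl }) x∈)))

-- Blossom trees

-- The bud of an inner node may sit, in contour order from the parent, before
-- the left subtree, between the subtrees or after the right subtree.
data Bud : Set where
  before between after : Bud

data Blossom : Set where
  leaf : Blossom
  node : Bud → Blossom → Blossom → Blossom

leaves : Blossom → ℕ
leaves leaf         = 1
leaves (node _ L R) = leaves L + leaves R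

_≟ᵇ_ : DecidableEquality Bud
before  ≟ᵇ before  = yes refl
before  ≟ᵇ between = no λ ()
before  ≟ᵇ after   = no λ ()
between ≟ᵇ before  = no λ ()
between ≟ᵇ between = yes refl
between ≟ᵇ after   = no λ ()
after   ≟ᵇ before  = no λ ()
after   ≟ᵇ between = no λ ()
after   ≟ᵇ after   = yes refl

_≟ᴮ_ : DecidableEquality Blossom
leaf       ≟ᴮ leaf       = yes refl
leaf       ≟ᴮ node _ _ _ = no λ ()
node _ _ _ ≟ᴮ leaf       = no λ ()
node b L R ≟ᴮ node c M S =
  map′ (λ { (refl , refl , refl) → refl }) (λ { refl → refl , refl , refl })
    ((b ≟ᵇ c) ×-dec ((L ≟ᴮ M) ×-dec (R ≟ᴮ S)))

leaves>0 : ∀ T → 0 < leaves T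
leaves>0 leaf         = s≤s z≤n
leaves>0 (node _ L R) = ℕₚ.≤-trans (leaves>0 L) (ℕₚ.m≤m+n _ _)

blossoms : ℕ → List Blossom
blossoms zero    = leaf ∷ []
blossoms (suc d) = leaf ∷ cartesianProductWith (λ b (L , R) → node b L R)
  (before ∷ between ∷ after ∷ []) (cartesianProduct (blossoms d) (blossoms d))

-- The parameter of `blossoms` bounds the depth. Each subtree has fewer leaves than its parent node,
-- as its sibling has at least one, so `suc d` leaves force depth at most `d`.
∈-blossoms : ∀ d T → leaves T ≤ suc d → T ∈ blossoms d
∈-blossoms zero    leaf         _ = here refl
∈-blossoms (suc d) leaf         _ = here refl
∈-blossoms zero    (node _ L R) l with ℕₚ.≤-trans (ℕₚ.+-mono-≤ (leaves>0 L) (leaves>0 R)) l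
... | s≤s ()
∈-blossoms (suc d) (node b L R) l = there (∈-cartesianProductWith⁺ (λ b (L , R) → node b L R) (b∈ b)
  (∈-cartesianProduct⁺
    (∈-blossoms d L (s≤s⁻¹ (ℕₚ.≤-trans L< l)))
    (∈-blossoms d R (s≤s⁻¹ (ℕₚ.≤-trans (ℕₚ.+-monoˡ-≤ (leaves R) (leaves>0 L)) l)))))
  where
  L< : leaves L < leaves L + leaves R
  L< = ℕₚ.m<m+n (leaves L) (leaves>0 R)
  b∈ : ∀ b → b ∈ before ∷ between ∷ after ∷ []
  b∈ before  = here refl
  b∈ between = there (here refl)
  b∈ after   = there (there (here refl))

-- Along the contour a bud is a step +1 and a leaf a step −1; a blossom tree
-- entered at height h is left at height h − 1.
leftHeight : Bud → ℤ → ℤ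
leftHeight before  h = sucℤ h
leftHeight between h = h
leftHeight after   h = h

rightHeight : Bud → ℤ → ℤ
rightHeight before  h = h
rightHeight between h = h
rightHeight after   h = predℤ h

heights : ℤ → Blossom → List ℤ
heights h leaf         = h ∷ []
heights h (node b L R) = heights (leftHeight b h) L ++ heights (rightHeight b h) R

length-heights : ∀ h T → length (heights h T) ≡ leaves T
length-heights h leaf         = refl
length-heights h (node b L R) = trans (length-++ (heights (leftHeight b h) L))
  (cong₂ _+_ (length-heights _ L) (length-heights _ R))

leftHeight-+ : ∀ b c h → leftHeight b (c +ᶻ h) ≡ c +ᶻ leftHeight b h
leftHeight-+ before  = lemma
  where
  lemma : ∀ c h → 1ℤ +ᶻ (c +ᶻ h) ≡ c +ᶻ (1ℤ +ᶻ h)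
  lemma = solve-∀
leftHeight-+ between c h = refl
leftHeight-+ after   c h = refl

rightHeight-+ : ∀ b c h → rightHeight b (c +ᶻ h) ≡ c +ᶻ rightHeight b h
rightHeight-+ before  c h = refl
rightHeight-+ between c h = refl
rightHeight-+ after   c h = sym (ℤₚ.+-pred c h)

heights-+ : ∀ c h T → heights (c +ᶻ h) T ≡ map (c +ᶻ_) (heights h T)
heights-+ c h leaf         = refl
heights-+ c h (node b L R) rewrite leftHeight-+ b c h | rightHeight-+ b c h =
  trans (cong₂ _++_ (heights-+ c _ L) (heights-+ c _ R)) (sym (map-++ (c +ᶻ_) (heights _ L) _))

-- Some subtree is always entered at height `h`: with the bud `before`, the rise and the left
-- subtree cancel and it is the right one; otherwise it is the left one.
start∈heights : ∀ h T → h ∈ heights h T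
start∈heights h leaf               = here refl
start∈heights h (node before  L R) = ∈-++⁺ʳ (heights (sucℤ h) L) (start∈heights h R)
start∈heights h (node between L R) = ∈-++⁺ˡ (start∈heights h L)
start∈heights h (node after   L R) = ∈-++⁺ˡ (start∈heights h L)

-- Bijection between blossom trees and embedded trees

graft : Tree ℤ → Tree ℤ → Tree ℤ
graft t (node a ts) = node a (t ∷ ts)

-- With W_h counting the trees with root label h and positive labels, this bijection
-- matches the recurrence W_h = 1 + g W_h (W_{h-1} + W_h + W_{h+1}): the two factors
-- are the rest of the tree and the first subtree of the root.
toTree : ℤ → Blossom → Tree ℤ
toTree h leaf               = node h []
toTree h (node before  L R) = graft (toTree (sucℤ h) L) (toTree h R)
toTree h (node between L R) = graft (toTree h L) (toTree h R)
toTree h (node after   L R) = graft (toTree (predℤ h) R) (toTree h L)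

-- join takes the label of the root minus the label of its first child.
join : ℤ → Blossom → Blossom → Blossom
join -[1+ _ ] X Y = node before X Y
join (+ 0)    X Y = node between X Y
join +[1+ _ ] X Y = node after Y X

mutual
  fromTree : Tree ℤ → Blossom
  fromTree (node a ts) = fromForest a ts

  fromForest : ℤ → List (Tree ℤ) → Blossom
  fromForest a []       = leaf
  fromForest a (t ∷ ts) = join (a ℤ.- root t) (fromTree t) (fromForest a ts)

root-graft : ∀ t T → root (graft t T) ≡ root T
root-graft t (node a ts) = refl

root-toTree : ∀ h T → root (toTree h T) ≡ h
root-toTree h leaf               = refl
root-toTree h (node before  L R) = trans (root-graft _ (toTree h R)) (root-toTree h R)
root-toTree h (node between L R) = trans (root-graft _ (toTree h R)) (root-toTree h R)
root-toTree h (node after   L R) = trans (root-graft _ (toTree h L)) (root-toTree h L)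

edges-graft : ∀ t T {l m} → suc (edges t) ≡ l → suc (edges T) ≡ m → suc (edges (graft t T)) ≡ l + m
edges-graft t (node a ts) refl refl = cong suc (sym (ℕₚ.+-suc (edges t) (edgesᶠ ts)))

edges-toTree : ∀ h T → suc (edges (toTree h T)) ≡ leaves T
edges-toTree h leaf               = refl
edges-toTree h (node before  L R) = edges-graft _ (toTree h R) (edges-toTree _ L) (edges-toTree h R)
edges-toTree h (node between L R) = edges-graft _ (toTree h R) (edges-toTree _ L) (edges-toTree h R)
edges-toTree h (node after   L R) =
  trans (edges-graft _ (toTree h L) (edges-toTree _ R) (edges-toTree h L)) (ℕₚ.+-comm (leaves R) _)

labels-graft : ∀ t T → labels (graft t T) ↭ labels t ++ labels T
labels-graft t (node a ts) = ↭-sym (shift a (labels t) (labelsᶠ ts))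

-- The order is not preserved: a tree lists its root first, and for the bud `after` the right
-- subtree becomes the first child.
labels-toTree : ∀ h T → labels (toTree h T) ↭ heights h T
labels-toTree h leaf               = ↭-refl
labels-toTree h (node before  L R) = ↭-trans (labels-graft _ (toTree h R)) (++⁺ (labels-toTree _ L) (labels-toTree h R))
labels-toTree h (node between L R) = ↭-trans (labels-graft _ (toTree h R)) (++⁺ (labels-toTree _ L) (labels-toTree h R))
labels-toTree h (node after   L R) = ↭-trans (labels-graft _ (toTree h L))
  (↭-trans (++⁺ (labels-toTree _ R) (labels-toTree h L)) (++-comm (heights (predℤ h) R) (heights h L)))

adjacentClose-graft : ∀ t T {i j} → root T ≡ i → root t ≡ j → Close i j →
                      AdjacentClose t → AdjacentClose T → AdjacentClose (graft t T)
adjacentClose-graft t (node a ts) refl refl close p (node ps) = node ((close , p) ∷ ps)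

i-suc[i]≡-1 : ∀ i → i ℤ.- sucℤ i ≡ -1ℤ
i-suc[i]≡-1 = lemma
  where
  lemma : ∀ i → i ℤ.- (1ℤ +ᶻ i) ≡ -1ℤ
  lemma = solve-∀

i-pred[i]≡1 : ∀ i → i ℤ.- predℤ i ≡ 1ℤ
i-pred[i]≡1 = lemma
  where
  lemma : ∀ i → i ℤ.- (-1ℤ +ᶻ i) ≡ 1ℤ
  lemma = solve-∀

adjacentClose-toTree : ∀ h T → AdjacentClose (toTree h T)
adjacentClose-toTree h leaf               = node []
adjacentClose-toTree h (node before  L R) = adjacentClose-graft _ _ (root-toTree h R) (root-toTree _ L)
  (ℕₚ.≤-reflexive (cong ∣_∣ (i-suc[i]≡-1 h))) (adjacentClose-toTree _ L) (adjacentClose-toTree h R)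
adjacentClose-toTree h (node between L R) = adjacentClose-graft _ _ (root-toTree h R) (root-toTree _ L)
  (ℕₚ.≤-trans (ℕₚ.≤-reflexive (cong ∣_∣ (ℤₚ.+-inverseʳ h))) z≤n) (adjacentClose-toTree _ L) (adjacentClose-toTree h R)
adjacentClose-toTree h (node after   L R) = adjacentClose-graft _ _ (root-toTree h L) (root-toTree _ R)
  (ℕₚ.≤-reflexive (cong ∣_∣ (i-pred[i]≡1 h))) (adjacentClose-toTree _ R) (adjacentClose-toTree h L)

fromTree-graft : ∀ t T {i j X Y} → root T ≡ i → root t ≡ j → fromTree t ≡ X → fromTree T ≡ Y →
                 fromTree (graft t T) ≡ join (i ℤ.- j) X Y
fromTree-graft t (node a ts) refl refl refl refl = refl

fromTree-toTree : ∀ h T → fromTree (toTree h T) ≡ T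
fromTree-toTree h leaf               = refl
fromTree-toTree h (node before  L R) = trans
  (fromTree-graft _ (toTree h R) (root-toTree h R) (root-toTree _ L) (fromTree-toTree _ L) (fromTree-toTree h R))
  (cong (λ d → join d L R) (i-suc[i]≡-1 h))
fromTree-toTree h (node between L R) = trans
  (fromTree-graft _ (toTree h R) (root-toTree h R) (root-toTree _ L) (fromTree-toTree _ L) (fromTree-toTree h R))
  (cong (λ d → join d L R) (ℤₚ.+-inverseʳ h))
fromTree-toTree h (node after   L R) = trans
  (fromTree-graft _ (toTree h L) (root-toTree h L) (root-toTree _ R) (fromTree-toTree _ R) (fromTree-toTree h L))
  (cong (λ d → join d R L) (i-pred[i]≡1 h))

toTree-injective : ∀ {h T U} → toTree h T ≡ toTree h U → T ≡ U
toTree-injective {h} {T} {U} eq =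
  trans (sym (fromTree-toTree h T)) (trans (cong fromTree eq) (fromTree-toTree h U))

toTree-join : ∀ i d X Y → ∣ d ∣ ≤ 1 →
              toTree i (join d X Y) ≡ graft (toTree (i ℤ.- d) X) (toTree i Y)
toTree-join i (+ 0)    X Y _ = cong (λ j → graft (toTree j X) (toTree i Y)) (sym (ℤₚ.+-identityʳ i))
toTree-join i +[1+ 0 ] X Y _ = cong (λ j → graft (toTree j X) (toTree i Y)) (ℤₚ.+-comm -1ℤ i)
toTree-join i -[1+ 0 ] X Y _ = cong (λ j → graft (toTree j X) (toTree i Y)) (ℤₚ.+-comm 1ℤ i)
toTree-join i +[1+ suc _ ] X Y (s≤s ())
toTree-join i -[1+ suc _ ] X Y (s≤s ())

i-[i-j]≡j : ∀ i j → i ℤ.- (i ℤ.- j) ≡ j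
i-[i-j]≡j = solve-∀

mutual
  toTree-fromTree : ∀ T → AdjacentClose T → toTree (root T) (fromTree T) ≡ T
  toTree-fromTree (node a ts) (node ps) = toTree-fromForest a ts ps

  toTree-fromForest : ∀ a ts → All (λ t → Close a (root t) × AdjacentClose t) ts →
                      toTree a (fromForest a ts) ≡ node a ts
  toTree-fromForest a []       []                 = refl
  toTree-fromForest a (t ∷ ts) ((close , p) ∷ ps) = begin
    toTree a (join (a ℤ.- root t) (fromTree t) (fromForest a ts))
      ≡⟨ toTree-join a (a ℤ.- root t) _ _ close ⟩
    graft (toTree (a ℤ.- (a ℤ.- root t)) (fromTree t)) (toTree a (fromForest a ts))
      ≡⟨ cong (λ j → graft (toTree j (fromTree t)) _) (i-[i-j]≡j a (root t)) ⟩
    graft (toTree (root t) (fromTree t)) (toTree a (fromForest a ts))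
      ≡⟨ cong₂ graft (toTree-fromTree t p) (toTree-fromForest a ts ps) ⟩
    node a (t ∷ ts) ∎
    where open ≡-Reasoning

-- Rerooting at the next leaf

-- Around an inner node lie parent, left and right in cyclic order, with the bud in one of the three
-- gaps. Seen from the left neighbour, the subtrees are the right one and then the old parent side,
-- so the same gap gets another name.
turn : Bud → Bud
turn before  = after
turn between = before
turn after   = between

-- T and S are the two sides of an edge; the result is their union, planted at
-- the first leaf of T.
descend : Blossom → Blossom → Blossom
descend leaf         S = S
descend (node b L R) S = descend L (node (turn b) R S)

reroot : Blossom → Blossom
reroot T = descend T leaf

leaves-descend : ∀ T S → suc (leaves (descend T S)) ≡ leaves T + leaves S
leaves-descend leaf         S = refl
leaves-descend (node b L R) S =
  trans (leaves-descend L (node (turn b) R S)) (sym (ℕₚ.+-assoc (leaves L) (leaves R) (leaves S)))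

leaves-reroot : ∀ T → leaves (reroot T) ≡ leaves T
leaves-reroot T = ℕₚ.suc-injective (trans (leaves-descend T leaf) (ℕₚ.+-comm (leaves T) 1))

first : ℤ → Blossom → ℤ
first h leaf         = h
first h (node b L R) = first (leftHeight b h) L

-- The bud stays in its place on the contour. Leaving the left subtree at `predℤ (leftHeight b h)`,
-- the walk therefore reaches the right subtree, and by `right-turn` the far side of the parent
-- edge, at the same heights whichever neighbour counts as parent.
left-turn : ∀ b h → leftHeight (turn b) (predℤ (leftHeight b h)) ≡ rightHeight b h
left-turn before  h = ℤₚ.pred-suc h
left-turn between h = ℤₚ.suc-pred h
left-turn after   h = refl

right-turn : ∀ b h → rightHeight (turn b) (predℤ (leftHeight b h)) ≡ predℤ h
right-turn before  h = cong predℤ (ℤₚ.pred-suc h)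
right-turn between h = refl
right-turn after   h = refl

-- Both sides read the same contour, through `T` and then through `S`. In `descend T S` the first
-- leaf of `T` is the root, so its height is split off.
heights-descend : ∀ h T S → heights h T ++ heights (predℤ h) S ≡
                            first h T ∷ heights (predℤ (first h T)) (descend T S)
heights-descend h leaf         S = refl
heights-descend h (node b L R) S = begin
  (heights (leftHeight b h) L ++ heights (rightHeight b h) R) ++ heights (predℤ h) S
    ≡⟨ ++-assoc (heights (leftHeight b h) L) _ _ ⟩
  heights (leftHeight b h) L ++ heights (rightHeight b h) R ++ heights (predℤ h) S
    ≡⟨ cong₂ (λ i j → heights (leftHeight b h) L ++ heights i R ++ heights j S) (left-turn b h) (right-turn b h) ⟨
  heights (leftHeight b h) L ++ heights (predℤ (leftHeight b h)) (node (turn b) R S)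
    ≡⟨ heights-descend (leftHeight b h) L (node (turn b) R S) ⟩
  first h (node b L R) ∷ heights (predℤ (first h (node b L R))) (descend L (node (turn b) R S)) ∎
  where open ≡-Reasoning

-- A tree together with the height at which its contour starts, so that the
-- heights need not be renormalised when the root moves.
State : Set
State = ℤ × Blossom

stateAt : ℤ → Blossom → Blossom → State
stateAt h T S = predℤ (first h T) , descend T S

step : State → State
step (h , T) = stateAt h T leaf

turn-turn-turn : ∀ b → turn (turn (turn b)) ≡ b
turn-turn-turn before  = refl
turn-turn-turn between = refl
turn-turn-turn after   = refl

-- The leaves of `T` are passed subtree by subtree; each time the node is seen from its next
-- neighbour, and the third turn restores it. The opposite side `S` must be arbitrary for this
-- induction, although only `S = leaf` is wanted.
iterate-step : ∀ h T S → iterate step (stateAt h T S) (leaves T) ≡ stateAt (predℤ h) S T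
iterate-step h leaf         S = refl
iterate-step h (node b L R) S = begin
  iterate step (stateAt l L (node (turn b) R S)) (leaves L + leaves R)
    ≡⟨ iterate-+ step _ (leaves L) (leaves R) ⟩
  iterate step (iterate step (stateAt l L (node (turn b) R S)) (leaves L)) (leaves R)
    ≡⟨ cong (λ σ → iterate step σ (leaves R)) (iterate-step l L (node (turn b) R S)) ⟩
  iterate step (stateAt (leftHeight (turn b) (predℤ l)) R (node (turn (turn b)) S L)) (leaves R)
    ≡⟨ iterate-step _ R (node (turn (turn b)) S L) ⟩
  stateAt (leftHeight (turn (turn b)) (predℤ (leftHeight (turn b) (predℤ l)))) S (node (turn (turn (turn b))) L R)
    ≡⟨ cong₂ (λ i c → stateAt i S (node c L R))
         (trans (left-turn (turn b) (predℤ l)) (right-turn b h)) (turn-turn-turn b) ⟩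
  stateAt (predℤ h) S (node b L R) ∎
  where
  open ≡-Reasoning
  l = leftHeight b h

step-periodic : ∀ h T → iterate step (h , T) (suc (leaves T)) ≡ (predℤ (predℤ h) , T)
step-periodic h T = iterate-step h T leaf

iterate-proj₂ : ∀ σ k → proj₂ (iterate step σ k) ≡ iterate reroot (proj₂ σ) k
iterate-proj₂ σ zero    = refl
iterate-proj₂ σ (suc k) = iterate-proj₂ (step σ) k

reroot-periodic : ∀ T → iterate reroot T (suc (leaves T)) ≡ T
reroot-periodic T = trans (sym (iterate-proj₂ (0ℤ , T) (suc (leaves T)))) (cong proj₂ (step-periodic 0ℤ T))

-- The cycle lemma

-2ℤ : ℤ
-2ℤ = -[1+ 1 ]

-- The last entry is the root leaf, reached when the walk has come down to `predℤ h`; this makes one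
-- full period.
contour : State → List ℤ
contour (h , T) = heights h T ++ predℤ h ∷ []

pred-pred : ∀ i → predℤ (predℤ i) ≡ -2ℤ +ᶻ i
pred-pred i = sym (ℤₚ.+-assoc -1ℤ -1ℤ i)

-- The first leaf becomes the root leaf, hence the last entry, and is met there one period later, 2
-- lower.
contour-step : ∀ σ {x xs} → contour σ ≡ x ∷ xs → contour (step σ) ≡ xs ++ -2ℤ +ᶻ x ∷ []
contour-step (h , T) eq with ∷-injective (trans (sym (heights-descend h T leaf)) eq)
... | refl , refl = cong (λ i → heights (predℤ (first h T)) (reroot T) ++ i ∷ []) (pred-pred (first h T))

contour-iterate : ∀ σ xs ys → contour σ ≡ xs ++ ys →
                  contour (iterate step σ (length xs)) ≡ ys ++ map (-2ℤ +ᶻ_) xs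
contour-iterate σ []       ys eq = trans eq (sym (++-identityʳ ys))
contour-iterate σ (x ∷ xs) ys eq = trans
  (contour-iterate (step σ) xs (ys ++ -2ℤ +ᶻ x ∷ []) (trans (contour-step σ eq) (++-assoc xs ys _)))
  (++-assoc ys _ _)

contour-pred-pred : ∀ h T → contour (predℤ (predℤ h) , T) ≡ map (-2ℤ +ᶻ_) (contour (h , T))
contour-pred-pred h T = begin
  heights (predℤ (predℤ h)) T ++ predℤ (predℤ (predℤ h)) ∷ []
    ≡⟨ cong₂ (λ i j → heights i T ++ j ∷ []) (pred-pred h) (pred-pred (predℤ h)) ⟩
  heights (-2ℤ +ᶻ h) T ++ -2ℤ +ᶻ predℤ h ∷ []
    ≡⟨ cong (_++ -2ℤ +ᶻ predℤ h ∷ []) (heights-+ -2ℤ h T) ⟩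
  map (-2ℤ +ᶻ_) (heights h T) ++ -2ℤ +ᶻ predℤ h ∷ []
    ≡⟨ map-++ (-2ℤ +ᶻ_) (heights h T) _ ⟨
  map (-2ℤ +ᶻ_) (contour (h , T)) ∎
  where open ≡-Reasoning

IsMin : ℤ → List ℤ → Set
IsMin m xs = m ∈ xs × All (m ≤ᶻ_) xs

isMin-unique : ∀ {m n xs} → IsMin m xs → IsMin n xs → m ≡ n
isMin-unique (m∈ , m≤) (n∈ , n≤) = ℤₚ.≤-antisym (All.lookup m≤ n∈) (All.lookup n≤ m∈)

isMin-map : ∀ c {m xs} → IsMin m xs → IsMin (c +ᶻ m) (map (c +ᶻ_) xs)
isMin-map c (m∈ , m≤) = ∈-map⁺ (c +ᶻ_) m∈ , Allₚ.map⁺ (All.map (ℤₚ.+-monoʳ-≤ c) m≤)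

min-isMin : ∀ x {xs} → x ∈ xs → IsMin (min x xs) xs
min-isMin x {xs} x∈ with argmin-sel id x xs
... | inj₁ eq  = subst (_∈ xs) (sym eq) x∈ , min≤xs x xs
... | inj₂ min∈ = min∈ , min≤xs x xs

Balanced : Blossom → Set
Balanced T = All (1ℤ ≤ᶻ_) (heights 1ℤ T)

balanced? : Decidable Balanced
balanced? T = All.all? (1ℤ ℤ.≤?_) (heights 1ℤ T)

heights-from-1 : ∀ h T → heights h T ≡ map (predℤ h +ᶻ_) (heights 1ℤ T)
heights-from-1 h T = trans (cong (λ i → heights i T) (lemma h)) (heights-+ (predℤ h) 1ℤ T)
  where
  lemma : ∀ h → h ≡ (-1ℤ +ᶻ h) +ᶻ 1ℤ
  lemma = solve-∀

balanced⇒≤ : ∀ h T → Balanced T → All (h ≤ᶻ_) (heights h T)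
balanced⇒≤ h T b = subst (All (h ≤ᶻ_)) (sym (heights-from-1 h T))
  (Allₚ.map⁺ (All.map (λ 1≤x → ℤₚ.≤-trans (ℤₚ.≤-reflexive (lemma h)) (ℤₚ.+-monoʳ-≤ (predℤ h) 1≤x)) b))
  where
  lemma : ∀ h → h ≡ (-1ℤ +ᶻ h) +ᶻ 1ℤ
  lemma = solve-∀

≤⇒balanced : ∀ h T → All (h ≤ᶻ_) (heights h T) → Balanced T
≤⇒balanced h T h≤ = All.map (λ {x} h≤x → subst₂ _≤ᶻ_ (lemma₁ h) (lemma₂ h x) (ℤₚ.+-monoʳ-≤ (1ℤ -ᶻ h) h≤x))
  (Allₚ.map⁻ (subst (All (h ≤ᶻ_)) (heights-from-1 h T) h≤))
  where
  lemma₁ : ∀ h → (1ℤ -ᶻ h) +ᶻ h ≡ 1ℤ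
  lemma₁ = solve-∀
  lemma₂ : ∀ h x → (1ℤ -ᶻ h) +ᶻ ((-1ℤ +ᶻ h) +ᶻ x) ≡ x
  lemma₂ = solve-∀

-- Let `s` be the start of the new tree; by balance it is the minimum of its heights. The entry
-- removed in front is `s + 1`, so `s` was already the old minimum, and the entry returns at the end
-- as `s - 1`, one below it.
isMin-step-balanced : ∀ h T {m} → Balanced (reroot T) →
                      IsMin m (contour (h , T)) → IsMin (predℤ m) (contour (step (h , T)))
isMin-step-balanced h T {m} b isMin rewrite heights-descend h T leaf =
  subst (λ i → IsMin (predℤ i) (contour (s , reroot T))) s≡m
    ( ∈-++⁺ʳ (heights s (reroot T)) (here refl)
    , Allₚ.++⁺ (All.map ℤₚ.i≤j⇒pred[i]≤j s≤) (ℤₚ.≤-refl ∷ []) )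
  where
  s  = predℤ (first h T)
  s≤ = balanced⇒≤ s (reroot T) b
  s≡m : s ≡ m
  s≡m = isMin-unique
    (there (start∈heights s (reroot T)) , ℤₚ.i≤j⇒pred[i]≤j ℤₚ.≤-refl ∷ s≤) isMin

-- Here `m < s`, since `s ≤ m` would make the new tree balanced. So the removed entry `s + 1` was
-- not the minimum, and its copy `s - 1` does not fall below `m`.
isMin-step-unbalanced : ∀ h T {m} → ¬ Balanced (reroot T) →
                        IsMin m (contour (h , T)) → IsMin m (contour (step (h , T)))
isMin-step-unbalanced h T {m} ¬b isMin rewrite heights-descend h T leaf with isMin
... | m∈ , m≤x ∷ m≤xs = m∈′ m∈ , Allₚ.++⁺ m≤xs (m≤s-1 ∷ [])
  where
  s = predℤ (first h T)
  m<s : m <ᶻ s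
  m<s = ℤₚ.≰⇒> λ s≤m → ¬b (≤⇒balanced s (reroot T) (All.map (ℤₚ.≤-trans s≤m) m≤xs))
  m≤s-1 : m ≤ᶻ predℤ s
  m≤s-1 = ℤₚ.i<j⇒i≤pred[j] m<s
  m∈′ : m ∈ first h T ∷ heights s (reroot T) → m ∈ contour (s , reroot T)
  m∈′ (here refl) = contradiction (ℤₚ.<-≤-trans m<s (ℤₚ.i≤j⇒pred[i]≤j ℤₚ.≤-refl)) (ℤₚ.<-irrefl refl)
  m∈′ (there m∈)  = ∈-++⁺ˡ m∈

isMin-iterate : ∀ σ k {m} → IsMin m (contour σ) →
  IsMin (m -ᶻ + count balanced? (List.iterate reroot (reroot (proj₂ σ)) k)) (contour (iterate step σ k))
isMin-iterate σ       zero    {m} isMin = subst (λ i → IsMin i (contour σ)) (sym (ℤₚ.+-identityʳ m)) isMin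
isMin-iterate (h , T) (suc k) {m} isMin with balanced? (reroot T)
... | yes b = subst (λ i → IsMin i (contour (iterate step (step (h , T)) k))) (lemma m _)
                (isMin-iterate (step (h , T)) k (isMin-step-balanced h T b isMin))
  where
  lemma : ∀ m c → (-1ℤ +ᶻ m) -ᶻ c ≡ m -ᶻ (1ℤ +ᶻ c)
  lemma = solve-∀
... | no ¬b = isMin-iterate (step (h , T)) k (isMin-step-unbalanced h T ¬b isMin)

-- A full turn lowers the whole contour, and so its minimum, by 2, while each balanced tree met on
-- the way lowers the minimum by exactly 1.
count-balanced-reroot : ∀ T → count balanced? (List.iterate reroot (reroot T) (suc (leaves T))) ≡ 2
count-balanced-reroot T = ℤₚ.+-injective (trans (lemma₁ m (+ c)) (trans (cong (m -ᶻ_) eq) (lemma₂ m)))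
  where
  c = count balanced? (List.iterate reroot (reroot T) (suc (leaves T)))
  m = min 0ℤ (contour (1ℤ , T))
  isMin : IsMin m (contour (1ℤ , T))
  isMin = min-isMin 0ℤ (∈-++⁺ʳ (heights 1ℤ T) (here refl))
  eq : m -ᶻ + c ≡ -2ℤ +ᶻ m
  eq = isMin-unique (isMin-iterate (1ℤ , T) (suc (leaves T)) isMin)
    (subst (IsMin (-2ℤ +ᶻ m))
      (sym (trans (cong contour (step-periodic 1ℤ T)) (contour-pred-pred 1ℤ T)))
      (isMin-map -2ℤ isMin))
  lemma₁ : ∀ m c → c ≡ m -ᶻ (m -ᶻ c)
  lemma₁ = solve-∀
  lemma₂ : ∀ m → m -ᶻ (-2ℤ +ᶻ m) ≡ + 2
  lemma₂ = solve-∀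

-- The minimum argument counts from the first rerooting on; applied to the predecessor of `T` in its
-- orbit, it counts from `T`.
count-balanced : ∀ T → count balanced? (List.iterate reroot T (suc (leaves T))) ≡ 2
count-balanced T = begin
  count balanced? (List.iterate reroot T (suc (leaves T)))
    ≡⟨ cong₂ (λ S l → count balanced? (List.iterate reroot S (suc l))) (sym reroot-U) (sym leaves-U) ⟩
  count balanced? (List.iterate reroot (reroot U) (suc (leaves U)))
    ≡⟨ count-balanced-reroot U ⟩
  2 ∎
  where
  open ≡-Reasoning
  U = iterate reroot T (leaves T)
  reroot-U : reroot U ≡ T
  reroot-U = trans (sym (iterate-suc reroot T (leaves T))) (reroot-periodic T)
  leaves-U : leaves U ≡ leaves T
  leaves-U = trans (sym (leaves-reroot U)) (cong leaves reroot-U)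

-- Label distributions

sum₁-cong : ∀ {f g} → (∀ k → f k ≡ g k) → ∀ n → sum₁ n f ≡ sum₁ n g
sum₁-cong eq zero    = refl
sum₁-cong eq (suc n) = cong₂ _+_ (sum₁-cong eq n) (eq (suc n))

count≤ : ℤ → List ℤ → ℕ
count≤ z = count (ℤ._≤? z)

count-≤-suc : ∀ z xs → count≤ z xs + count (ℤ._≟ sucℤ z) xs ≡ count≤ (sucℤ z) xs
count-≤-suc z []       = refl
count-≤-suc z (x ∷ xs) with x ℤ.≤? z | x ℤ.≟ sucℤ z | x ℤ.≤? sucℤ z
... | yes _   | no _    | yes _    = cong suc (count-≤-suc z xs)
... | no _    | yes _   | yes _    = trans (ℕₚ.+-suc _ _) (cong suc (count-≤-suc z xs))
... | no _    | no _    | no _     = count-≤-suc z xs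
... | yes x≤z | yes refl | _       = contradiction (ℤₚ.suc[i]≤j⇒i<j x≤z) (ℤₚ.<-irrefl refl)
... | yes x≤z | no _    | no x≰    = contradiction (ℤₚ.≤-trans x≤z (ℤₚ.i≤suc[i] z)) x≰
... | no _    | yes refl | no x≰   = contradiction ℤₚ.≤-refl x≰
... | no x≰z  | no x≢   | yes x≤   =
  contradiction (ℤₚ.≤-antisym x≤ (ℤₚ.i<j⇒suc[i]≤j (ℤₚ.≰⇒> x≰z))) x≢

sum₁-count : ∀ {m xs} → All (m ≤ᶻ_) xs → ∀ k →
  sum₁ k (λ ℓ → count (ℤ._≟ (m +ᶻ + ℓ -ᶻ 1ℤ)) xs) ≡ count≤ (m +ᶻ + k -ᶻ 1ℤ) xs
sum₁-count {m} {xs} m≤ zero = sym (cong length (filter-none (ℤ._≤? (m +ᶻ 0ℤ -ᶻ 1ℤ)) (All.map above m≤)))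
  where
  lemma : ∀ m → m +ᶻ 0ℤ -ᶻ 1ℤ ≡ -1ℤ +ᶻ m
  lemma = solve-∀
  above : ∀ {x} → m ≤ᶻ x → ¬ x ≤ᶻ m +ᶻ 0ℤ -ᶻ 1ℤ
  above m≤x x≤ = ℤₚ.<-irrefl refl
    (ℤₚ.i≤pred[j]⇒i<j (ℤₚ.≤-trans m≤x (ℤₚ.≤-trans x≤ (ℤₚ.≤-reflexive (lemma m)))))
sum₁-count {m} {xs} m≤ (suc k) = begin
  sum₁ k (λ ℓ → count (ℤ._≟ (m +ᶻ + ℓ -ᶻ 1ℤ)) xs) + count (ℤ._≟ (m +ᶻ + suc k -ᶻ 1ℤ)) xs
    ≡⟨ cong (_+ count (ℤ._≟ (m +ᶻ + suc k -ᶻ 1ℤ)) xs) (sum₁-count m≤ k) ⟩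
  count≤ z xs + count (ℤ._≟ (m +ᶻ + suc k -ᶻ 1ℤ)) xs
    ≡⟨ cong (λ i → count≤ z xs + count (ℤ._≟ i) xs) (lemma m (+ k)) ⟩
  count≤ z xs + count (ℤ._≟ sucℤ z) xs
    ≡⟨ count-≤-suc z xs ⟩
  count≤ (sucℤ z) xs
    ≡⟨ cong (λ i → count≤ i xs) (lemma m (+ k)) ⟨
  count≤ (m +ᶻ + suc k -ᶻ 1ℤ) xs ∎
  where
  open ≡-Reasoning
  z = m +ᶻ + k -ᶻ 1ℤ
  lemma : ∀ m k → m +ᶻ (1ℤ +ᶻ k) -ᶻ 1ℤ ≡ 1ℤ +ᶻ (m +ᶻ k -ᶻ 1ℤ)
  lemma = solve-∀

root∈labels : ∀ (T : Tree ℤ) → root T ∈ labels T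
root∈labels (node _ _) = here refl

-- `Λ̂` is relative to the minimum, so the contour may start at any height `h`: the shift by `c`
-- moves labels, minimum and threshold alike.
Λ̂-toTree : ∀ h T k {m} → IsMin m (heights h T) →
           Λ̂ k (toTree 1ℤ T) ≡ count≤ (m +ᶻ + k -ᶻ 1ℤ) (heights h T)
Λ̂-toTree h T k {m} isMin = begin
  Λ̂ k U
    ≡⟨ sum₁-count (proj₂ minU) k ⟩
  count≤ (minLabel U +ᶻ + k -ᶻ 1ℤ) (labels U)
    ≡⟨ count-↭ (ℤ._≤? (minLabel U +ᶻ + k -ᶻ 1ℤ)) labels↭ ⟩
  count≤ (minLabel U +ᶻ + k -ᶻ 1ℤ) (map (c +ᶻ_) (heights h T))
    ≡⟨ cong (λ i → count≤ (i +ᶻ + k -ᶻ 1ℤ) (map (c +ᶻ_) (heights h T)))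
            (isMin-unique (isMin-↭ labels↭ minU) (isMin-map c isMin)) ⟩
  count≤ (c +ᶻ m +ᶻ + k -ᶻ 1ℤ) (map (c +ᶻ_) (heights h T))
    ≡⟨ count-map (ℤ._≤? (c +ᶻ m +ᶻ + k -ᶻ 1ℤ)) (c +ᶻ_) (heights h T) ⟩
  count (λ x → c +ᶻ x ℤ.≤? (c +ᶻ m +ᶻ + k -ᶻ 1ℤ)) (heights h T)
    ≡⟨ count-cong _ (ℤ._≤? z) (All.universal (λ x → cancel x , addˡ x) (heights h T)) ⟩
  count≤ z (heights h T) ∎
  where
  open ≡-Reasoning
  U = toTree 1ℤ T
  c = 1ℤ -ᶻ h
  z = m +ᶻ + k -ᶻ 1ℤ
  minU : IsMin (minLabel U) (labels U)
  minU = min-isMin (root U) (root∈labels U)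
  isMin-↭ : ∀ {m xs ys} → xs ↭ ys → IsMin m xs → IsMin m ys
  isMin-↭ p (m∈ , m≤) = ∈-resp-↭ p m∈ , All-resp-↭ p m≤
  lemma₁ : ∀ h → 1ℤ ≡ (1ℤ -ᶻ h) +ᶻ h
  lemma₁ = solve-∀
  lemma₂ : ∀ c m k → c +ᶻ m +ᶻ k -ᶻ 1ℤ ≡ c +ᶻ (m +ᶻ k -ᶻ 1ℤ)
  lemma₂ = solve-∀
  lemma₃ : ∀ c x → (0ℤ -ᶻ c) +ᶻ (c +ᶻ x) ≡ x
  lemma₃ = solve-∀
  labels↭ : labels U ↭ map (c +ᶻ_) (heights h T)
  labels↭ = ↭-trans (labels-toTree 1ℤ T)
    (↭-reflexive (trans (cong (λ i → heights i T) (lemma₁ h)) (heights-+ c h T)))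
  cancel : ∀ x → c +ᶻ x ≤ᶻ c +ᶻ m +ᶻ + k -ᶻ 1ℤ → x ≤ᶻ z
  cancel x le = subst₂ _≤ᶻ_ (lemma₃ c x) (trans (cong ((0ℤ -ᶻ c) +ᶻ_) (lemma₂ c m (+ k))) (lemma₃ c z))
    (ℤₚ.+-monoʳ-≤ (0ℤ -ᶻ c) le)
  addˡ : ∀ x → x ≤ᶻ z → c +ᶻ x ≤ᶻ c +ᶻ m +ᶻ + k -ᶻ 1ℤ
  addˡ x le = ℤₚ.≤-trans (ℤₚ.+-monoʳ-≤ c le) (ℤₚ.≤-reflexive (sym (lemma₂ c m (+ k))))

1+i-1≡i : ∀ i → 1ℤ +ᶻ i -ᶻ 1ℤ ≡ i
1+i-1≡i = solve-∀

λ̂-toTree : ∀ T k → Balanced T → λ̂ k (toTree 1ℤ T) ≡ count≤ (+ k) (heights 1ℤ T)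
λ̂-toTree T k b = begin
  sum₁ k (λ ℓ → count (ℤ._≟ + ℓ) (labels W))
    ≡⟨ sum₁-cong (λ ℓ → cong (λ i → count (ℤ._≟ i) (labels W)) (sym (1+i-1≡i (+ ℓ)))) k ⟩
  sum₁ k (λ ℓ → count (ℤ._≟ (1ℤ +ᶻ + ℓ -ᶻ 1ℤ)) (labels W))
    ≡⟨ sum₁-count (All-resp-↭ (↭-sym (labels-toTree 1ℤ T)) b) k ⟩
  count≤ (1ℤ +ᶻ + k -ᶻ 1ℤ) (labels W)
    ≡⟨ cong (λ i → count≤ i (labels W)) (1+i-1≡i (+ k)) ⟩
  count≤ (+ k) (labels W)
    ≡⟨ count-↭ (ℤ._≤? + k) (labels-toTree 1ℤ T) ⟩
  count≤ (+ k) (heights 1ℤ T) ∎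
  where
  open ≡-Reasoning
  W = toTree 1ℤ T

-- Contours of leaf heights: any number of rises, then the recorded height x,
-- then the fall of the leaf itself to x − 1.
data Walk : ℤ → List ℤ → ℤ → Set where
  []  : ∀ {h e} → h ≤ᶻ e → Walk h [] e
  _∷_ : ∀ {h x xs e} → h ≤ᶻ x → Walk (predℤ x) xs e → Walk h (x ∷ xs) e

walk-resp-≤ : ∀ {g h xs e f} → g ≤ᶻ h → e ≤ᶻ f → Walk h xs e → Walk g xs f
walk-resp-≤ g≤h e≤f ([] h≤e)  = [] (ℤₚ.≤-trans g≤h (ℤₚ.≤-trans h≤e e≤f))
walk-resp-≤ g≤h e≤f (h≤x ∷ w) = ℤₚ.≤-trans g≤h h≤x ∷ walk-resp-≤ ℤₚ.≤-refl e≤f w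

walk-++ : ∀ {h xs e ys f} → Walk h xs e → Walk e ys f → Walk h (xs ++ ys) f
walk-++ ([] h≤e)  v = walk-resp-≤ h≤e ℤₚ.≤-refl v
walk-++ (h≤x ∷ w) v = h≤x ∷ walk-++ w v

walk-heights : ∀ h T → Walk h (heights h T) (predℤ h)
walk-heights h leaf         = ℤₚ.≤-refl ∷ [] ℤₚ.≤-refl
walk-heights h (node b L R) =
  walk-++ (walk-resp-≤ (h≤left b) (left≤right b) (walk-heights _ L))
          (walk-resp-≤ ℤₚ.≤-refl (right≤h b) (walk-heights _ R))
  where
  h≤left : ∀ b → h ≤ᶻ leftHeight b h
  h≤left before  = ℤₚ.i≤suc[i] h
  h≤left between = ℤₚ.≤-refl
  h≤left after   = ℤₚ.≤-refl
  left≤right : ∀ b → predℤ (leftHeight b h) ≤ᶻ rightHeight b h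
  left≤right before  = ℤₚ.≤-reflexive (ℤₚ.pred-suc h)
  left≤right between = ℤₚ.i≤j⇒pred[i]≤j ℤₚ.≤-refl
  left≤right after   = ℤₚ.≤-refl
  right≤h : ∀ b → predℤ (rightHeight b h) ≤ᶻ predℤ h
  right≤h before  = ℤₚ.≤-refl
  right≤h between = ℤₚ.≤-refl
  right≤h after   = ℤₚ.pred-mono (ℤₚ.i≤j⇒pred[i]≤j (ℤₚ.≤-refl {h}))

walk-suffix : ∀ {h} xs {x ys e} → Walk h (xs ++ x ∷ ys) e → Walk (predℤ x) ys e
walk-suffix []       (_ ∷ w) = w
walk-suffix (_ ∷ xs) (_ ∷ w) = walk-suffix xs w

-- Rises are unrestricted, but every fall is by 1 and starts at a recorded height. A walk that gets
-- from `k` or above to below `k` must therefore record `k`.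
walk-passes : ∀ {h xs e k} → Walk h xs e → e <ᶻ k → k ≤ᶻ h → k ∈ xs
walk-passes ([] h≤e) e<k k≤h = contradiction (ℤₚ.<-≤-trans e<k (ℤₚ.≤-trans k≤h h≤e)) (ℤₚ.<-irrefl refl)
walk-passes {k = k} (_∷_ {x = x} h≤x w) e<k k≤h with k ℤ.≟ x
... | yes refl = here refl
... | no k≢x   = there (walk-passes w e<k (ℤₚ.i<j⇒i≤pred[j] (ℤₚ.≤∧≢⇒< (ℤₚ.≤-trans k≤h h≤x) k≢x)))

-- If the lost leaf x lies above k, the walk from x down to 0 still passes
-- through k, which makes up for the new leaf at 0.
count-tail-< : ∀ {x ys k} → Walk (predℤ x) ys 0ℤ → 0ℤ <ᶻ k →
               count≤ (-2ℤ +ᶻ k) ys < count≤ k (x ∷ ys)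
count-tail-< {x} {ys} {k} w 0<k with x ℤ.≤? k
... | yes _  = s≤s (count-mono (ℤ._≤? (-2ℤ +ᶻ k)) (ℤ._≤? k) (λ le → ℤₚ.≤-trans le k-2≤k) ys)
  where
  k-2≤k : -2ℤ +ᶻ k ≤ᶻ k
  k-2≤k = ℤₚ.≤-trans (ℤₚ.+-monoˡ-≤ k ℤ.-≤+) (ℤₚ.≤-reflexive (ℤₚ.+-identityˡ k))
... | no x≰k = count-strictMono (ℤ._≤? (-2ℤ +ᶻ k)) (ℤ._≤? k) (λ le → ℤₚ.≤-trans le (ℤₚ.<⇒≤ k-2<k))
    (walk-passes w 0<k (ℤₚ.i<j⇒i≤pred[j] (ℤₚ.≰⇒> x≰k)))
    (λ k≤k-2 → ℤₚ.<-irrefl refl (ℤₚ.≤-<-trans k≤k-2 k-2<k)) ℤₚ.≤-refl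
  where
  k-2<k : -2ℤ +ᶻ k <ᶻ k
  k-2<k = ℤₚ.<-≤-trans (ℤₚ.+-monoˡ-< k ℤ.-<+) (ℤₚ.≤-reflexive (ℤₚ.+-identityˡ k))

-- Comparing a well labelled tree with its rerootings

split-at : ∀ {A : Set} k (xs : List A) → k < length xs →
           ∃[ ys ] ∃[ y ] ∃[ zs ] xs ≡ ys ++ y ∷ zs × length ys ≡ k
split-at zero    (x ∷ xs) _         = [] , x , xs , refl , refl
split-at (suc k) (x ∷ xs) (s≤s k<l) with split-at k xs k<l
... | ys , y , zs , refl , refl = x ∷ ys , y , zs , refl , refl

-- The entry 0 is the old root leaf. The leaf `x` is now the root leaf: it ends the contour as
-- `x - 2` and is stripped off, because `heights` omits the root leaf.
heights-iterate : ∀ T xs {x ys} → heights 1ℤ T ≡ xs ++ x ∷ ys →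
  let U = iterate reroot T (suc (length xs)) in
  ∃[ h ] heights h U ≡ ys ++ 0ℤ ∷ map (-2ℤ +ᶻ_) xs
heights-iterate T xs {x} {ys} eq = h , trans (cong (heights h) (sym (iterate-proj₂ (1ℤ , T) (suc (length xs)))))
  (∷ʳ-injectiveˡ _ _ (begin
    contour σ
      ≡⟨ cong (λ k → contour (iterate step (1ℤ , T) k)) length-snoc ⟨
    contour (iterate step (1ℤ , T) (length (xs ++ x ∷ [])))
      ≡⟨ contour-iterate (1ℤ , T) (xs ++ x ∷ []) (ys ++ 0ℤ ∷ []) split ⟩
    (ys ++ 0ℤ ∷ []) ++ map (-2ℤ +ᶻ_) (xs ++ x ∷ [])
      ≡⟨ ++-assoc ys _ _ ⟩
    ys ++ 0ℤ ∷ map (-2ℤ +ᶻ_) (xs ++ x ∷ [])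
      ≡⟨ cong (λ zs → ys ++ 0ℤ ∷ zs) (map-++ (-2ℤ +ᶻ_) xs _) ⟩
    ys ++ 0ℤ ∷ map (-2ℤ +ᶻ_) xs ++ -2ℤ +ᶻ x ∷ []
      ≡⟨ ++-assoc ys _ _ ⟨
    (ys ++ 0ℤ ∷ map (-2ℤ +ᶻ_) xs) ++ -2ℤ +ᶻ x ∷ [] ∎))
  where
  open ≡-Reasoning
  σ = iterate step (1ℤ , T) (suc (length xs))
  h = proj₁ σ
  length-snoc : length (xs ++ x ∷ []) ≡ suc (length xs)
  length-snoc = trans (length-++ xs) (ℕₚ.+-comm (length xs) 1)
  split : contour (1ℤ , T) ≡ (xs ++ x ∷ []) ++ ys ++ 0ℤ ∷ []
  split = trans (cong (_++ 0ℤ ∷ []) eq) (trans (++-assoc xs _ _) (sym (++-assoc xs _ _)))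

module _ {xs : List ℤ} {x : ℤ} {ys : List ℤ} {m : ℤ}
         (walk : Walk 1ℤ (xs ++ x ∷ ys) 0ℤ) (1≤ : All (1ℤ ≤ᶻ_) (xs ++ x ∷ ys))
         (isMin : IsMin m (ys ++ 0ℤ ∷ map (-2ℤ +ᶻ_) xs)) {k : ℕ} (1≤k : 1 ≤ k) where

  private
    rerooted = ys ++ 0ℤ ∷ map (-2ℤ +ᶻ_) xs

    m≤0 : m ≤ᶻ 0ℤ
    m≤0 = All.lookup (proj₂ isMin) (∈-++⁺ʳ ys (here refl))

    -1≤m : -1ℤ ≤ᶻ m
    -1≤m = All.lookup (Allₚ.++⁺ (All.map (ℤₚ.≤-trans ℤ.-≤+) (All.tail (Allₚ.++⁻ʳ xs 1≤)))
      (ℤ.-≤+ ∷ Allₚ.map⁺ (All.map (ℤₚ.+-monoʳ-≤ -2ℤ) (Allₚ.++⁻ˡ xs 1≤)))) (proj₁ isMin)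

  -- Since `m ≤ 0`, the threshold on the left is at most `k - 2`. The leaves in `xs` drop by 2 along
  -- with it and contribute the same; `count-tail-<` pays for the new leaf at 0.
  rerooted-lower : count≤ (m +ᶻ + (k ∸ 2) -ᶻ 1ℤ) rerooted ≤ count≤ (+ k) (xs ++ x ∷ ys)
  rerooted-lower = begin
    count≤ (m +ᶻ + (k ∸ 2) -ᶻ 1ℤ) rerooted
      ≤⟨ count-mono _ (ℤ._≤? (-2ℤ +ᶻ + k)) (λ le → ℤₚ.≤-trans le bound) rerooted ⟩
    count≤ (-2ℤ +ᶻ + k) rerooted
      ≡⟨ count-++ (ℤ._≤? (-2ℤ +ᶻ + k)) ys _ ⟩
    count≤ (-2ℤ +ᶻ + k) ys + count≤ (-2ℤ +ᶻ + k) (0ℤ ∷ map (-2ℤ +ᶻ_) xs)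
      ≤⟨ ℕₚ.+-monoʳ-≤ _ (count-∷-≤ (ℤ._≤? (-2ℤ +ᶻ + k)) 0ℤ _) ⟩
    count≤ (-2ℤ +ᶻ + k) ys + suc (count≤ (-2ℤ +ᶻ + k) (map (-2ℤ +ᶻ_) xs))
      ≡⟨ ℕₚ.+-suc _ _ ⟩
    suc (count≤ (-2ℤ +ᶻ + k) ys) + count≤ (-2ℤ +ᶻ + k) (map (-2ℤ +ᶻ_) xs)
      ≡⟨ cong (λ c → suc (count≤ (-2ℤ +ᶻ + k) ys) + c) (count-map (ℤ._≤? (-2ℤ +ᶻ + k)) (-2ℤ +ᶻ_) xs) ⟩
    suc (count≤ (-2ℤ +ᶻ + k) ys) + count (λ y → -2ℤ +ᶻ y ℤ.≤? (-2ℤ +ᶻ + k)) xs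
      ≤⟨ ℕₚ.+-mono-≤ (count-tail-< {x} (walk-suffix xs walk) (ℤ.+<+ 1≤k))
                     (count-mono _ (ℤ._≤? + k) cancel xs) ⟩
    count≤ (+ k) (x ∷ ys) + count≤ (+ k) xs
      ≡⟨ ℕₚ.+-comm _ (count≤ (+ k) xs) ⟩
    count≤ (+ k) xs + count≤ (+ k) (x ∷ ys)
      ≡⟨ count-++ (ℤ._≤? + k) xs (x ∷ ys) ⟨
    count≤ (+ k) (xs ++ x ∷ ys) ∎
    where
    open ℕₚ.≤-Reasoning
    cancel : ∀ {y} → -2ℤ +ᶻ y ≤ᶻ -2ℤ +ᶻ + k → y ≤ᶻ + k
    cancel le = subst₂ _≤ᶻ_ (lemma _) (lemma _) (ℤₚ.+-monoʳ-≤ (+ 2) le)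
      where
      lemma : ∀ i → + 2 +ᶻ (-2ℤ +ᶻ i) ≡ i
      lemma = solve-∀
    -- At `k = 1` the truncated difference is 0 rather than -1, and the inequality is tight.
    k∸2<k : suc (k ∸ 2) ≤ k
    k∸2<k = ℕₚ.≤-trans (s≤s (ℕₚ.∸-monoʳ-≤ k (s≤s (z≤n {1})))) (ℕₚ.≤-reflexive (ℕₚ.m+[n∸m]≡n 1≤k))
    bound : m +ᶻ + (k ∸ 2) -ᶻ 1ℤ ≤ᶻ -2ℤ +ᶻ + k
    bound = subst₂ _≤ᶻ_ (lemma m (+ (k ∸ 2))) (ℤₚ.+-identityˡ _)
      (ℤₚ.+-mono-≤ m≤0 (ℤₚ.+-monoʳ-≤ -2ℤ (ℤ.+≤+ k∸2<k)))
      where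
      lemma : ∀ m j → m +ᶻ (-2ℤ +ᶻ (1ℤ +ᶻ j)) ≡ m +ᶻ j -ᶻ 1ℤ
      lemma = solve-∀

  -- The surviving leaves are only lowered or fixed, and the new leaf at 0, always counted, makes up
  -- for the lost `x`. Since `m` is at least -1, the threshold on the right is at least `k`.
  rerooted-upper : count≤ (+ k) (xs ++ x ∷ ys) ≤ count≤ (m +ᶻ + (k + 2) -ᶻ 1ℤ) rerooted
  rerooted-upper = begin
    count≤ (+ k) (xs ++ x ∷ ys)
      ≡⟨ count-++ (ℤ._≤? + k) xs (x ∷ ys) ⟩
    count≤ (+ k) xs + count≤ (+ k) (x ∷ ys)
      ≤⟨ ℕₚ.+-monoʳ-≤ _ (count-∷-≤ (ℤ._≤? + k) x ys) ⟩
    count≤ (+ k) xs + suc (count≤ (+ k) ys)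
      ≡⟨ ℕₚ.+-comm (count≤ (+ k) xs) _ ⟩
    suc (count≤ (+ k) ys) + count≤ (+ k) xs
      ≡⟨ ℕₚ.+-suc _ _ ⟨
    count≤ (+ k) ys + suc (count≤ (+ k) xs)
      ≤⟨ ℕₚ.+-monoʳ-≤ _ (s≤s (count-mono (ℤ._≤? + k) _ drop xs)) ⟩
    count≤ (+ k) ys + suc (count (λ y → -2ℤ +ᶻ y ℤ.≤? + k) xs)
      ≡⟨ cong (λ c → count≤ (+ k) ys + suc c) (count-map (ℤ._≤? + k) (-2ℤ +ᶻ_) xs) ⟨
    count≤ (+ k) ys + suc (count≤ (+ k) (map (-2ℤ +ᶻ_) xs))
      ≡⟨ cong (λ c → count≤ (+ k) ys + c) (count-accept (ℤ._≤? + k) (ℤ.+≤+ z≤n) (map (-2ℤ +ᶻ_) xs)) ⟨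
    count≤ (+ k) ys + count≤ (+ k) (0ℤ ∷ map (-2ℤ +ᶻ_) xs)
      ≡⟨ count-++ (ℤ._≤? + k) ys _ ⟨
    count≤ (+ k) rerooted
      ≤⟨ count-mono (ℤ._≤? + k) _ (λ le → ℤₚ.≤-trans le bound) rerooted ⟩
    count≤ (m +ᶻ + (k + 2) -ᶻ 1ℤ) rerooted ∎
    where
    open ℕₚ.≤-Reasoning
    drop : ∀ {y} → y ≤ᶻ + k → -2ℤ +ᶻ y ≤ᶻ + k
    drop {y} le = ℤₚ.≤-trans (ℤₚ.≤-trans (ℤₚ.+-monoˡ-≤ y ℤ.-≤+) (ℤₚ.≤-reflexive (ℤₚ.+-identityˡ y))) le
    bound : + k ≤ᶻ m +ᶻ + (k + 2) -ᶻ 1ℤ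
    bound = ℤₚ.≤-trans (ℤₚ.≤-reflexive (lemma (+ k)))
      (ℤₚ.+-monoˡ-≤ -1ℤ (ℤₚ.+-monoˡ-≤ (+ (k + 2)) -1≤m))
      where
      lemma : ∀ i → i ≡ -1ℤ +ᶻ (i +ᶻ + 2) -ᶻ 1ℤ
      lemma = solve-∀

Λ̂-bounds-reroot : ∀ T xs {x ys} k → heights 1ℤ T ≡ xs ++ x ∷ ys → Balanced T → 1 ≤ k →
  let W = toTree 1ℤ T
      U = toTree 1ℤ (iterate reroot T (suc (length xs)))
  in Λ̂ (k ∸ 2) U ≤ λ̂ k W × λ̂ k W ≤ Λ̂ (k + 2) U
Λ̂-bounds-reroot T xs {x} {ys} k eq b 1≤k =
    subst₂ _≤_ (sym (Λ̂≡ (k ∸ 2))) (sym λ̂≡) (rerooted-lower walk 1≤ isMin 1≤k)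
  , subst₂ _≤_ (sym λ̂≡) (sym (Λ̂≡ (k + 2))) (rerooted-upper walk 1≤ isMin 1≤k)
  where
  U = iterate reroot T (suc (length xs))
  rerooted = ys ++ 0ℤ ∷ map (-2ℤ +ᶻ_) xs
  m = min 0ℤ rerooted
  h = proj₁ (heights-iterate T xs eq)
  heights-U : heights h U ≡ rerooted
  heights-U = proj₂ (heights-iterate T xs eq)
  walk : Walk 1ℤ (xs ++ x ∷ ys) 0ℤ
  walk = subst (λ zs → Walk 1ℤ zs 0ℤ) eq (walk-heights 1ℤ T)
  1≤ : All (1ℤ ≤ᶻ_) (xs ++ x ∷ ys)
  1≤ = subst (All (1ℤ ≤ᶻ_)) eq b
  isMin : IsMin m rerooted
  isMin = min-isMin 0ℤ (∈-++⁺ʳ ys (here refl))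
  λ̂≡ : λ̂ k (toTree 1ℤ T) ≡ count≤ (+ k) (xs ++ x ∷ ys)
  λ̂≡ = trans (λ̂-toTree T k b) (cong (count≤ (+ k)) eq)
  Λ̂≡ : ∀ j → Λ̂ j (toTree 1ℤ U) ≡ count≤ (m +ᶻ + j -ᶻ 1ℤ) rerooted
  Λ̂≡ j = trans (Λ̂-toTree h U j (subst (IsMin m) (sym heights-U) isMin))
    (cong (count≤ (m +ᶻ + j -ᶻ 1ℤ)) heights-U)

Λ̂-bounds : ∀ T q k → q < suc (leaves T) → Balanced T → 1 ≤ k →
  let W = toTree 1ℤ T
      U = toTree 1ℤ (iterate reroot T q)
  in Λ̂ (k ∸ 2) U ≤ λ̂ k W × λ̂ k W ≤ Λ̂ (k + 2) U
Λ̂-bounds T zero k _ b _ = below , above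
  where
  Λ̂≡ : ∀ j → Λ̂ j (toTree 1ℤ T) ≡ count≤ (+ j) (heights 1ℤ T)
  Λ̂≡ j = trans (Λ̂-toTree 1ℤ T j (start∈heights 1ℤ T , b))
    (cong (λ i → count≤ i (heights 1ℤ T)) (1+i-1≡i (+ j)))
  mono : ∀ {i j} → i ≤ j → count≤ (+ i) (heights 1ℤ T) ≤ count≤ (+ j) (heights 1ℤ T)
  mono i≤j = count-mono _ _ (λ le → ℤₚ.≤-trans le (ℤ.+≤+ i≤j)) (heights 1ℤ T)
  below : Λ̂ (k ∸ 2) (toTree 1ℤ T) ≤ λ̂ k (toTree 1ℤ T)
  below = subst₂ _≤_ (sym (Λ̂≡ (k ∸ 2))) (sym (λ̂-toTree T k b)) (mono (ℕₚ.m∸n≤m k 2))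
  above : λ̂ k (toTree 1ℤ T) ≤ Λ̂ (k + 2) (toTree 1ℤ T)
  above = subst₂ _≤_ (sym (λ̂-toTree T k b)) (sym (Λ̂≡ (k + 2))) (mono (ℕₚ.m≤m+n k 2))
-- The new root is leaf number `q` counted from 0; it exists because `suc q` is less than a full
-- turn.
Λ̂-bounds T (suc q) k (s≤s q<) b 1≤k
  with split-at q (heights 1ℤ T) (subst (q <_) (sym (length-heights 1ℤ T)) q<)
... | xs , _ , _ , eq , refl = Λ̂-bounds-reroot T xs k eq b 1≤k

-- Conjugacy classes

open Orbits _≟ᴮ_ reroot leaves leaves-reroot reroot-periodic

blossomsOfSize : ℕ → List Blossom
blossomsOfSize n = filter (λ T → leaves T ℕ.≟ suc n) (blossoms n)

∈-blossomsOfSize⁺ : ∀ {n} T → leaves T ≡ suc n → T ∈ blossomsOfSize n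
∈-blossomsOfSize⁺ {n} T eq = ∈-filter⁺ (λ T → leaves T ℕ.≟ suc n) (∈-blossoms n T (ℕₚ.≤-reflexive eq)) eq

∈-blossomsOfSize⁻ : ∀ {n T} → T ∈ blossomsOfSize n → leaves T ≡ suc n
∈-blossomsOfSize⁻ {n} T∈ = proj₂ (∈-filter⁻ (λ T → leaves T ℕ.≟ suc n) {xs = blossoms n} T∈)

toTree-𝒰 : ∀ {n} T → leaves T ≡ suc n → 𝒰 n (toTree 1ℤ T)
toTree-𝒰 T eq =
  ℕₚ.suc-injective (trans (edges-toTree 1ℤ T) eq) , root-toTree 1ℤ T , adjacentClose-toTree 1ℤ T

𝒰-toTree : ∀ {n U} → 𝒰 n U → ∃[ T ] toTree 1ℤ T ≡ U × leaves T ≡ suc n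
𝒰-toTree {n} {U} (edges≡n , root≡1 , close) = fromTree U , toTree≡U ,
  trans (sym (edges-toTree 1ℤ (fromTree U))) (cong suc (trans (cong edges toTree≡U) edges≡n))
  where
  toTree≡U : toTree 1ℤ (fromTree U) ≡ U
  toTree≡U = trans (cong (λ i → toTree i (fromTree U)) (sym root≡1)) (toTree-fromTree U close)

𝒲⇒balanced : ∀ {n} T → 𝒲 n (toTree 1ℤ T) → Balanced T
𝒲⇒balanced T (_ , positive) = All-resp-↭ (labels-toTree 1ℤ T) (All.map ℤₚ.i<j⇒suc[i]≤j positive)

balanced⇒𝒲 : ∀ {n} T → leaves T ≡ suc n → Balanced T → 𝒲 n (toTree 1ℤ T)
balanced⇒𝒲 T eq b = toTree-𝒰 T eq , All-resp-↭ (↭-sym (labels-toTree 1ℤ T)) (All.map ℤₚ.suc[i]≤j⇒i<j b)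

conjugates : Blossom → List (Tree ℤ)
conjugates T = map (toTree 1ℤ) (orbit T)

conjugacyClasses : ℕ → List (List (Tree ℤ))
conjugacyClasses n = map (map (toTree 1ℤ)) (orbits (blossomsOfSize n))

∈-conjugacyClasses⁻ : ∀ n {C} → C ∈ conjugacyClasses n → ∃[ T ] leaves T ≡ suc n × C ≡ conjugates T
∈-conjugacyClasses⁻ n C∈ with ∈-map⁻ (map (toTree 1ℤ)) C∈
... | _ , O∈ , refl with ∈-orbits⁻ (blossomsOfSize n) O∈
...   | T , T∈ , refl = T , ∈-blossomsOfSize⁻ T∈ , refl

∈-conjugates⁻ : ∀ {n U} T → leaves T ≡ suc n → U ∈ conjugates T →
                ∃[ S ] U ≡ toTree 1ℤ S × T ~ S × leaves S ≡ suc n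
∈-conjugates⁻ T leaves-T U∈ with ∈-map⁻ (toTree 1ℤ) U∈
... | S , S∈ , eq = S , eq , ∈-orbit⁻ S∈ , trans (ν-resp-~ (∈-orbit⁻ S∈)) leaves-T

conjugacyClasses-isPartition : ∀ n → IsPartition (𝒰 n) (conjugacyClasses n)
conjugacyClasses-isPartition n = record
  { unique   = All.tabulate unique
  ; nonEmpty = All.tabulate nonEmpty
  ; disjoint = AllPairsₚ.map⁺ (AllPairs.map disjoint (orbits-disjoint (blossomsOfSize n)))
  ; union    = λ U → mk⇔ covers inside
  }
  where
  unique : ∀ {C} → C ∈ conjugacyClasses n → _
  unique C∈ with ∈-conjugacyClasses⁻ n C∈
  ... | T , _ , refl = Uniqueₚ.map⁺ toTree-injective (orbit-unique T)

  nonEmpty : ∀ {C} → C ∈ conjugacyClasses n → C ≢ []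
  nonEmpty C∈ with ∈-conjugacyClasses⁻ n C∈
  ... | _ , _ , refl = λ ()

  disjoint : ∀ {xs ys} → Disjoint xs ys → Disjoint (map (toTree 1ℤ) xs) (map (toTree 1ℤ) ys)
  disjoint d (U∈xs , U∈ys) with ∈-map⁻ (toTree 1ℤ) U∈xs | ∈-map⁻ (toTree 1ℤ) U∈ys
  ... | _ , S∈ , refl | _ , T∈ , eq = d (S∈ , subst (_∈ _) (sym (toTree-injective eq)) T∈)

  covers : ∀ {U} → 𝒰 n U → Any (U ∈_) (conjugacyClasses n)
  covers U∈𝒰 with 𝒰-toTree U∈𝒰
  ... | T , refl , eq = Anyₚ.map⁺ (Any.map (∈-map⁺ (toTree 1ℤ)) (orbits-cover (∈-blossomsOfSize⁺ T eq)))

  inside : ∀ {U} → Any (U ∈_) (conjugacyClasses n) → 𝒰 n U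
  inside {U} U∈ =
    let C , C∈ , U∈C          = find U∈
        T , leaves-T , C≡     = ∈-conjugacyClasses⁻ n C∈
        S , U≡S , _ , leaves-S = ∈-conjugates⁻ T leaves-T (subst (U ∈_) C≡ U∈C)
    in subst (𝒰 n) (sym U≡S) (toTree-𝒰 S leaves-S)

length-conjugates-≤ : ∀ {n} T → leaves T ≡ suc n → length (conjugates T) ≤ n + 2
length-conjugates-≤ {n} T eq = begin
  length (conjugates T) ≡⟨ length-map (toTree 1ℤ) (orbit T) ⟩
  length (orbit T)      ≤⟨ length-orbit-≤ T ⟩
  suc (leaves T)        ≡⟨ cong suc eq ⟩
  2 + n                 ≡⟨ ℕₚ.+-comm 2 n ⟩
  n + 2                 ∎
  where open ℕₚ.≤-Reasoning

count-𝒲-conjugates : ∀ {n} T → leaves T ≡ suc n →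
  2 * length (conjugates T) ≡ (n + 2) * count (𝒲? n) (conjugates T)
count-𝒲-conjugates {n} T eq = begin
  2 * length (conjugates T)
    ≡⟨ cong (2 *_) (length-map (toTree 1ℤ) (orbit T)) ⟩
  2 * length (orbit T)
    ≡⟨ ℕₚ.*-comm 2 (length (orbit T)) ⟩
  length (orbit T) * 2
    ≡⟨ cong (length (orbit T) *_) (count-balanced T) ⟨
  length (orbit T) * count balanced? (List.iterate reroot T (suc (leaves T)))
    ≡⟨ count-orbit balanced? T ⟩
  suc (leaves T) * count balanced? (orbit T)
    ≡⟨ cong (λ l → suc l * count balanced? (orbit T)) eq ⟩
  (2 + n) * count balanced? (orbit T)
    ≡⟨ cong₂ _*_ (ℕₚ.+-comm 2 n) (count-cong balanced? (𝒲? n ∘ toTree 1ℤ) (All.tabulate balanced⇔𝒲)) ⟩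
  (n + 2) * count (𝒲? n ∘ toTree 1ℤ) (orbit T)
    ≡⟨ cong ((n + 2) *_) (count-map (𝒲? n) (toTree 1ℤ) (orbit T)) ⟨
  (n + 2) * count (𝒲? n) (conjugates T) ∎
  where
  open ≡-Reasoning
  balanced⇔𝒲 : ∀ {S} → S ∈ orbit T →
    (Balanced S → 𝒲 n (toTree 1ℤ S)) × (𝒲 n (toTree 1ℤ S) → Balanced S)
  balanced⇔𝒲 {S} S∈ = balanced⇒𝒲 S (trans (ν-resp-~ (∈-orbit⁻ S∈)) eq) , 𝒲⇒balanced S

-- The base point `T` of the class need not be balanced, so the rerootings are counted from the tree
-- of `W`; periodicity brings the tree of `U` within one turn of it.
conjugates-bounds : ∀ {n} T → leaves T ≡ suc n → ∀ W U → 𝒲 n W → W ∈ conjugates T → U ∈ conjugates T →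
  ∀ k → 1 ≤ k → Λ̂ (k ∸ 2) U ≤ λ̂ k W × λ̂ k W ≤ Λ̂ (k + 2) U
conjugates-bounds {n} T eq W U W∈𝒲 W∈ U∈ k 1≤k =
  let R , W≡R , T~R , _ = ∈-conjugates⁻ T eq W∈
      S , U≡S , T~S , _ = ∈-conjugates⁻ T eq U∈
      q , q< , Rᵠ≡S     = ~-bounded (~-trans (~-sym T~R) T~S)
  in subst₂ (λ W U → Λ̂ (k ∸ 2) U ≤ λ̂ k W × λ̂ k W ≤ Λ̂ (k + 2) U)
       (sym W≡R) (trans (cong (toTree 1ℤ) Rᵠ≡S) (sym U≡S))
       (Λ̂-bounds R q k q< (𝒲⇒balanced R (subst (𝒲 n) W≡R W∈𝒲)) 1≤k)

theorem2 : (n : ℕ) → 1 ≤ n →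
    Σ[ 𝒞 ∈ List (List (Tree ℤ)) ]
    IsPartition (𝒰 n) 𝒞 ×
    (∀ C → C ∈ 𝒞 →
    length C ≤ n + 2 ×
    2 * length C ≡ (n + 2) * length (filter (𝒲? n) C) ×
    (∀ W U → 𝒲 n W → W ∈ C → U ∈ C → ∀ k → 1 ≤ k →
    Λ̂ (k ∸ 2) U ≤ λ̂ k W × λ̂ k W ≤ Λ̂ (k + 2) U))
theorem2 n _ = conjugacyClasses n , conjugacyClasses-isPartition n , classes
  where
  classes : ∀ C → C ∈ conjugacyClasses n → _
  classes C C∈ with ∈-conjugacyClasses⁻ n C∈
  ... | T , eq , refl = length-conjugates-≤ T eq , count-𝒲-conjugates T eq , conjugates-bounds T eq
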